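{- Any $2$-layer $2$-planar graph on $n$ vertices has at most $\frac{5}{3}n-\frac{7}{3}$ edges. Moreover, the optimal $2$-layer $2$-planar graphs with exactly $\frac{5}{3}n-\frac{7}{3}$ edges are sequences of $K_{2,3}$'s such that consecutive $K_{2,3}$'s share one planar edge.
   Context: A topological $2$-layer graph is a bipartite graph $G=(U\,\dot\cup\,V,E)$, $E\subseteq U\times V$, drawn in the plane so that the vertices of $U$ and of $V$ are mapped to distinct points on two horizontal lines $L_u$ and $L_v$, respectively, and the edges are mapped to $y$-monotone Jordan arcs; the drawing is assumed simple, i.e. no two adjacent edges cross and every two independent edges cross at most once. The vertices are denoted $u_1,\dots,u_p$ along $L_u$ and $v_1,\dots,v_q$ along $L_v$ in left-to-right order, and $n=p+q$. A topological $2$-layer graph is $k$-planar if each edge is crossed at most $k$ times. A bipartite graph is $2$-layer $k$-planar if it is isomorphic to the underlying abstract graph of some topological $2$-layer $k$-planar graph. For a graph class $\mathcal C$, let $m_{\mathcal C}(n)$ be the maximum number of edges of an $n$-vertex graph in $\mathcal C$. The (maximum edge) density of $\mathcal C$ is a function $d_{\mathcal C}$ with $d_{\mathcal C}(n)\ge m_{\mathcal C}(n)$ for every $n$ and $d_{\mathcal C}(n)=m_{\mathcal C}(n)$ for infinitely many $n$. An $n$-vertex graph in $\mathcal C$ with $d_{\mathcal C}(n)$ edges is called optimal. An edge of a topological $2$-layer graph is planar if it is crossing-free in the drawing. A brick is a subgraph induced by vertices $\{u_i,\dots,u_j,v_x,\dots,v_y\}$ (with $i\le j$, $x\le y$) such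 that $(u_i,v_x)$ and $(u_j,v_y)$ are two distinct edges that are crossing-free in the whole drawing. "Sequence of $K_{2,3}$'s such that consecutive $K_{2,3}$'s share one planar edge" means that the graph has a topological $2$-layer drawing whose planar edges separate it, from left to right, into a sequence of bricks $(b_1,\dots,b_\beta)$ such that each $b_r$ is a complete bipartite graph $K_{2,3}$ (either of the two layers may be the one containing two of its vertices) and $b_r$ and $b_{r+1}$ share one planar edge. -}

module Defs where

open import Algebra.Bundles using (CommutativeRing)
open import Data.Empty using (⊥)
open import Data.Fin as Fin using (Fin; zero; suc; toℕ; fromℕ; inject₁)
open import Data.List using (List; length; filter; allFin; cartesianProduct)
open import Data.List.Relation.Unary.All using (All)
open import Data.List.Relation.Unary.Unique.Propositional using (Unique)
open import Data.Nat as ℕ using (ℕ)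
open import Data.Product using (Σ-syntax; ∃-syntax; _×_; _,_; proj₁; proj₂)
open import Data.Sum using (_⊎_; inj₁; inj₂)
open import Function.Bundles using (_⇔_; _↔_; Inverse)
open import Level using (0ℓ)
open import Relation.Binary using (Rel; Symmetric; Irreflexive; Decidable; IsStrictTotalOrder)
import Relation.Binary.Construct.StrictToNonStrict as StrictToNonStrict
open import Relation.Binary.PropositionalEquality using (_≡_; _≢_)
open import Relation.Nullary using (¬_; no)
open import Relation.Nullary.Decidable using (_×-dec_)
open import Relation.Unary using (Pred)
import Relation.Unary as Unary

-- The real numbers, given by the axioms that determine them up to
-- isomorphism.  Trichotomy and suprema of arbitrary predicates are the
-- classical axioms; everything below takes such a structure as a parameter.
record CompleteOrderedField : Set₁ where
  field
    commutativeRing : CommutativeRing 0ℓ 0ℓ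
  open CommutativeRing commutativeRing public
  infix 4 _<_
  field
    _<_                : Rel Carrier 0ℓ
    isStrictTotalOrder : IsStrictTotalOrder _≈_ _<_
    0<1                : 0# < 1#
    +-monoˡ-<          : ∀ {x y} z → x < y → (x + z) < (y + z)
    *-pos              : ∀ {x y} → 0# < x → 0# < y → 0# < (x * y)
    inverse            : ∀ {x} → ¬ (x ≈ 0#) → ∃[ y ] (x * y) ≈ 1#

  open StrictToNonStrict _≈_ _<_ public using (_≤_)

  UpperBound : Pred Carrier 0ℓ → Carrier → Set
  UpperBound S b = ∀ {x} → S x → x ≤ b

  field
    supremum : (S : Pred Carrier 0ℓ) → ∃[ x ] S x → ∃[ b ] UpperBound S b →
               ∃[ s ] (UpperBound S s × (∀ b → UpperBound S b → s ≤ b))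

record Graph (V : Set) : Set₁ where
  infix 4 _~_ _~?_
  field
    _~_      : Rel V 0ℓ
    _~?_     : Decidable _~_
    ~-sym    : Symmetric _~_
    ~-irrefl : Irreflexive _≡_ _~_

record _≅_ {V W : Set} (G : Graph V) (H : Graph W) : Set where
  private
    module G = Graph G
    module H = Graph H
  field
    bijection : V ↔ W
  open Inverse bijection using (to)
  field
    adjacency : ∀ x y → (x G.~ y) ⇔ (to x H.~ to y)

edges : ∀ {n} → Graph (Fin n) → List (Fin n × Fin n)
edges {n} G = filter (λ (i , j) → (i Fin.<? j) ×-dec (i ~? j))
                     (cartesianProduct (allFin n) (allFin n))
  where open Graph G

∣E∣ : ∀ {n} → Graph (Fin n) → ℕ
∣E∣ G = length (edges G)

module TwoLayer (ℝ : CompleteOrderedField) where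
  open CompleteOrderedField ℝ using (Carrier; _≈_; _<_; _≤_; 0#; _+_; _-_)

  ContinuousOn[_,_] : Carrier → Carrier → (Carrier → Carrier) → Set
  ContinuousOn[ a , b ] f =
    ∀ t → a ≤ t → t ≤ b → ∀ ε → 0# < ε →
    ∃[ δ ] (0# < δ × (∀ s → a ≤ s → s ≤ b → (t - δ) < s → s < (t + δ) →
                      (f t - ε) < f s × f s < (f t + ε)))

  -- f lies to the left of g just before t and to the right of g just after t.
  PassesAt : (f g : Carrier → Carrier) → Carrier → Set
  PassesAt f g t =
    ∃[ δ ] (0# < δ × (∀ s → (t - δ) < s → s < t → f s < g s)
                   × (∀ s → t < s → s < (t + δ) → g s < f s))

  -- The y-axis is directed from L_u, the line y = yᵤ, to L_v, the line y = yᵥ.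
  -- A y-monotone Jordan arc meets each horizontal line between its endpoints
  -- exactly once, so it is the graph of a continuous function x = arc e y on
  -- [yᵤ, yᵥ].  The values of arc e elsewhere, and of arc e for a pair e that
  -- is not an edge, carry no meaning.
  record TopologicalGraph : Set₁ where
    field
      p q   : ℕ
      Edge  : Pred (Fin p × Fin q) 0ℓ
      Edge? : Unary.Decidable Edge

      yᵤ yᵥ : Carrier
      yᵤ<yᵥ : yᵤ < yᵥ

      -- The indices number the vertices of each layer from left to right.
      xᵤ      : Fin p → Carrier
      xᵥ      : Fin q → Carrier
      xᵤ-mono : ∀ {i j} → i Fin.< j → xᵤ i < xᵤ j
      xᵥ-mono : ∀ {i j} → i Fin.< j → xᵥ i < xᵥ j

      arc       : Fin p × Fin q → Carrier → Carrier
      arc-cont  : ∀ e → Edge e → ContinuousOn[ yᵤ , yᵥ ] (arc e)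
      arc-start : ∀ e → Edge e → arc e yᵤ ≈ xᵤ (proj₁ e)
      arc-end   : ∀ e → Edge e → arc e yᵥ ≈ xᵥ (proj₂ e)

    -- The arcs of e and f have a common interior point at height t.
    MeetAt : (e f : Fin p × Fin q) → Carrier → Set
    MeetAt e f t = yᵤ < t × t < yᵥ × arc e t ≈ arc f t

    Adjacent : Rel (Fin p × Fin q) 0ℓ
    Adjacent e f = e ≢ f × (proj₁ e ≡ proj₁ f ⊎ proj₂ e ≡ proj₂ f)

    Independent : Rel (Fin p × Fin q) 0ℓ
    Independent e f = proj₁ e ≢ proj₁ f × proj₂ e ≢ proj₂ f

    field
      -- As usual for topological graphs, arcs do not touch or overlap: every
      -- common interior point of two edges is a proper crossing.
      proper : ∀ e f t → Edge e → Edge f → e ≢ f → MeetAt e f t →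
               PassesAt (arc e) (arc f) t ⊎ PassesAt (arc f) (arc e) t

      adjacent-don't-cross :
        ∀ e f t → Edge e → Edge f → Adjacent e f → ¬ MeetAt e f t
      independent-cross-≤1 :
        ∀ e f s t → Edge e → Edge f → Independent e f →
        MeetAt e f s → MeetAt e f t → s ≈ t

    Crosses : Rel (Fin p × Fin q) 0ℓ
    Crosses e f = e ≢ f × ∃[ t ] MeetAt e f t

    Planar : Pred (Fin p × Fin q) 0ℓ
    Planar e = Edge e × (∀ f → Edge f → ¬ Crosses e f)

    -- In a simple drawing the crossings on e correspond to the edges
    -- crossing e.
    IsPlanar : ℕ → Set
    IsPlanar k = ∀ e → Edge e → (fs : List (Fin p × Fin q)) → Unique fs →
                 All Edge fs → All (Crosses e) fs → length fs ℕ.≤ k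

  underlying : (T : TopologicalGraph) → let open TopologicalGraph T in
               Graph (Fin p ⊎ Fin q)
  underlying T = record
    { _~_ = _~_ ; _~?_ = _~?_
    ; ~-sym    = λ {a} {b} → sym′ a b
    ; ~-irrefl = λ {a} {b} → irrefl′ a b
    }
    where
    open TopologicalGraph T

    _~_ : Rel (Fin p ⊎ Fin q) 0ℓ
    inj₁ u ~ inj₂ v = Edge (u , v)
    inj₂ v ~ inj₁ u = Edge (u , v)
    inj₁ _ ~ inj₁ _ = ⊥
    inj₂ _ ~ inj₂ _ = ⊥

    _~?_ : Decidable _~_
    inj₁ u ~? inj₂ v = Edge? (u , v)
    inj₂ v ~? inj₁ u = Edge? (u , v)
    inj₁ _ ~? inj₁ _ = no λ ()
    inj₂ _ ~? inj₂ _ = no λ ()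

    sym′ : ∀ a b → a ~ b → b ~ a
    sym′ (inj₁ _) (inj₂ _) e = e
    sym′ (inj₂ _) (inj₁ _) e = e

    irrefl′ : ∀ a b → a ≡ b → ¬ (a ~ b)
    irrefl′ (inj₁ _) (inj₁ _) _ ()
    irrefl′ (inj₂ _) (inj₂ _) _ ()
    irrefl′ (inj₁ _) (inj₂ _) ()
    irrefl′ (inj₂ _) (inj₁ _) ()

  Is2Layer[_]Planar : ℕ → ∀ {n} → Graph (Fin n) → Set₁
  Is2Layer[ k ]Planar G =
    Σ[ T ∈ TopologicalGraph ]
      (G ≅ underlying T × TopologicalGraph.IsPlanar T k)

  module _ (T : TopologicalGraph) where
    open TopologicalGraph T

    -- The brick induced by {u_i,…,u_j, v_x,…,v_y}, where l = (u_i , v_x) and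
    -- r = (u_j , v_y).
    record IsBrick (l r : Fin p × Fin q) : Set where
      field
        planarˡ  : Planar l
        planarʳ  : Planar r
        distinct : l ≢ r
        i≤j      : proj₁ l Fin.≤ proj₁ r
        x≤y      : proj₂ l Fin.≤ proj₂ r

    -- This brick has a vertices on L_u and b on L_v and is complete bipartite.
    record IsK (a b : ℕ) (l r : Fin p × Fin q) : Set where
      field
        sizeᵤ    : ℕ.suc (toℕ (proj₁ r)) ≡ a ℕ.+ toℕ (proj₁ l)
        sizeᵥ    : ℕ.suc (toℕ (proj₂ r)) ≡ b ℕ.+ toℕ (proj₂ l)
        complete : ∀ (u : Fin p) (v : Fin q) →
                   proj₁ l Fin.≤ u → u Fin.≤ proj₁ r →
                   proj₂ l Fin.≤ v → v Fin.≤ proj₂ r → Edge (u , v)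

    -- The planar edges are e_0,…,e_β, and brick b_{r+1} lies between e_r and
    -- e_{r+1}, so consecutive bricks share exactly the planar edge between
    -- them.  As e_0 and e_β are the two ends of the drawing, the bricks
    -- contain all vertices; an edge contained in no brick would cross some
    -- e_r.  For β = 0 the graph is a single edge.
    record IsSequenceOfK₂₃ : Set where
      field
        β           : ℕ
        boundary    : Fin (ℕ.suc β) → Fin p × Fin q
        planarEdges : ∀ e → Planar e ⇔ (∃[ r ] e ≡ boundary r)
        leftEnd     : ∀ (u : Fin p) (v : Fin q) →
                      proj₁ (boundary zero) Fin.≤ u ×
                      proj₂ (boundary zero) Fin.≤ v
        rightEnd    : ∀ (u : Fin p) (v : Fin q) →
                      u Fin.≤ proj₁ (boundary (fromℕ β)) ×
                      v Fin.≤ proj₂ (boundary (fromℕ β))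
        brick       : ∀ r → IsBrick (boundary (inject₁ r)) (boundary (suc r))
        K₂₃         : ∀ r → IsK 2 3 (boundary (inject₁ r)) (boundary (suc r))
                          ⊎ IsK 3 2 (boundary (inject₁ r)) (boundary (suc r))

  SequenceOfK₂₃ : ∀ {n} → Graph (Fin n) → Set₁
  SequenceOfK₂₃ G =
    Σ[ T ∈ TopologicalGraph ] (G ≅ underlying T × IsSequenceOfK₂₃ T)

{-# OPTIONS --safe #-}
module Submission where

-- A simple drawing is determined by the order of its ends: two edges cross iff
-- their ends are ordered oppositely on the two layers.  Let (i , j) be the pair
-- of leftmost vertices.  If one of them has no edge besides (i , j), drop it.
-- Otherwise every further edge at i crosses every further edge at j, so each
-- vertex has at most two of them.  With one at each, drop both vertices and at
-- most 3 edges.  With two at each, all four are saturated, which allows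
-- dropping 4 vertices and at most 5 edges.  With two at i and one at j, the
-- latter is saturated and at most one further edge crosses the longest edge at
-- i, so 3 vertices and at most 5 edges are dropped.  This keeps the ratio 5/3,
-- and only the last case is tight; then the dropped part completes to a K₂,₃
-- whose right end is the leftmost pair of the rest.

open import Defs
import Algebra.Properties.AbelianGroup as AbelianGroupProperties
open import Data.Product using (Σ-syntax; ∃-syntax; _×_; _,_; proj₁; proj₂; swap)
open import Data.Sum using (_⊎_; inj₁; inj₂) renaming (map to ⊎-map; swap to ⊎-swap)
open import Relation.Binary using (tri<; tri≈; tri>; IsStrictTotalOrder)
import Relation.Binary.Construct.StrictToNonStrict as StrictToNonStrict
import Relation.Binary.Reasoning.Setoid as SetoidReasoning
open import Relation.Nullary using (¬_; Dec; yes; no; contradiction)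

-- Crossings of arcs

module Real (ℝ : CompleteOrderedField) where
  open CompleteOrderedField ℝ
  open IsStrictTotalOrder isStrictTotalOrder
    using (compare; <-resp-≈; <-respʳ-≈; <-respˡ-≈; asym; irrefl) renaming (trans to <-trans) public
  open AbelianGroupProperties +-abelianGroup using (//-rightDividesˡ; //-rightDividesʳ)
  open TwoLayer ℝ using (ContinuousOn[_,_])

  private
    module ≤ = StrictToNonStrict _≈_ _<_

  <-≤-trans : ∀ {x y z} → x < y → y ≤ z → x < z
  <-≤-trans = ≤.<-≤-trans <-trans <-respʳ-≈

  ≤-<-trans : ∀ {x y z} → x ≤ y → y < z → x < z
  ≤-<-trans = ≤.≤-<-trans sym <-trans <-respˡ-≈

  ≤-trans : ∀ {x y z} → x ≤ y → y ≤ z → x ≤ z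
  ≤-trans = ≤.trans isEquivalence <-resp-≈ <-trans

  ≤-refl : ∀ {x} → x ≤ x
  ≤-refl = inj₂ refl

  <⇒≱ : ∀ {x y} → x < y → ¬ (y ≤ x)
  <⇒≱ x<y y≤x = irrefl refl (<-≤-trans x<y y≤x)

  x<x+ε : ∀ {x ε} → 0# < ε → x < (x + ε)
  x<x+ε {x} {ε} 0<ε = <-respˡ-≈ (+-identityˡ x) (<-respʳ-≈ (+-comm ε x) (+-monoˡ-< x 0<ε))

  x-ε<x : ∀ {x ε} → 0# < ε → (x - ε) < x
  x-ε<x {x} {ε} 0<ε = <-respʳ-≈ (//-rightDividesˡ ε x) (x<x+ε 0<ε)

  0<y-x : ∀ {x y} → x < y → 0# < (y - x)
  0<y-x {x} {y} x<y = <-respˡ-≈ (-‿inverseʳ x) (+-monoˡ-< (- x) x<y)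

  -- Two is invertible because `0# < 1# < 1# + 1#`.
  half : ∀ {d} → 0# < d → ∃[ ε ] (0# < ε × (ε + ε) ≈ d)
  half {d} 0<d with inverse (λ 2≈0 → irrefl (sym 2≈0) (<-trans 0<1 (x<x+ε 0<1)))
  ... | h , 2h≈1 = ε , positive , ε+ε≈d
    where
    ε : Carrier
    ε = h * d
    open SetoidReasoning setoid
    ε+ε≈d : (ε + ε) ≈ d
    ε+ε≈d = begin
      h * d + h * d         ≈⟨ distribʳ d h h ⟨
      (h + h) * d           ≈⟨ *-congʳ (+-cong (*-identityˡ h) (*-identityˡ h)) ⟨
      (1# * h + 1# * h) * d ≈⟨ *-congʳ (distribʳ h 1# 1#) ⟨
      ((1# + 1#) * h) * d   ≈⟨ *-congʳ 2h≈1 ⟩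
      1# * d                ≈⟨ *-identityˡ d ⟩
      d                     ∎
    -- The sign of `ε` is read off from that of `ε + ε`, which is `d`.
    positive : 0# < ε
    positive with compare 0# ε
    ... | tri< 0<ε _ _ = 0<ε
    ... | tri≈ _ 0≈ε _ = contradiction 0<d (irrefl (trans (sym (+-identityʳ 0#)) (trans (+-cong 0≈ε 0≈ε) ε+ε≈d)))
    ... | tri> _ _ ε<0 = contradiction 0<d (asym (<-respˡ-≈ ε+ε≈d
                           (<-trans (+-monoˡ-< ε ε<0) (<-respˡ-≈ (sym (+-identityˡ ε)) ε<0))))

  between : ∀ {x y} → x < y → ∃[ z ] (x < z × z < y)
  between {x} {y} x<y with half (0<y-x x<y)
  ... | ε , 0<ε , 2ε≈ = x + ε , x<x+ε 0<ε , <-respʳ-≈ eq (x<x+ε 0<ε)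
    where
    open SetoidReasoning setoid
    eq : ((x + ε) + ε) ≈ y
    eq = begin
      (x + ε) + ε ≈⟨ +-assoc x ε ε ⟩
      x + (ε + ε) ≈⟨ +-congˡ 2ε≈ ⟩
      x + (y - x) ≈⟨ +-comm x (y - x) ⟩
      (y - x) + x ≈⟨ //-rightDividesˡ x y ⟩
      y           ∎

  below-both : ∀ x y {z} → z < x → z < y → ∃[ w ] (z < w × w ≤ x × w ≤ y)
  below-both x y z<x z<y with compare x y
  ... | tri< x<y _ _ = x , z<x , ≤-refl , inj₁ x<y
  ... | tri≈ _ x≈y _ = x , z<x , ≤-refl , inj₂ x≈y
  ... | tri> _ _ y<x = y , z<y , inj₁ y<x , ≤-refl

  above-both : ∀ x y {z} → x < z → y < z → ∃[ w ] (w < z × x ≤ w × y ≤ w)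
  above-both x y x<z y<z with compare x y
  ... | tri< x<y _ _ = y , y<z , inj₁ x<y , ≤-refl
  ... | tri≈ _ x≈y _ = y , y<z , inj₂ x≈y , ≤-refl
  ... | tri> _ _ y<x = x , x<z , ≤-refl , inj₁ y<x

  between-below : ∀ x y {z} → z < x → z < y → ∃[ w ] (z < w × w < x × w < y)
  between-below x y z<x z<y with below-both x y z<x z<y
  ... | m , z<m , m≤x , m≤y with between z<m
  ...   | w , z<w , w<m = w , z<w , <-≤-trans w<m m≤x , <-≤-trans w<m m≤y

  between-above : ∀ x y {z} → x < z → y < z → ∃[ w ] (w < z × x < w × y < w)
  between-above x y x<z y<z with above-both x y x<z y<z
  ... | m , m<z , x≤m , y≤m with between m<z
  ...   | w , m<w , w<z = w , w<z , ≤-<-trans x≤m m<w , ≤-<-trans y≤m m<w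

  neg-mono : ∀ {x y} → x < y → (- y) < (- x)
  neg-mono {x} {y} x<y = <-respˡ-≈ lhs (<-respʳ-≈ rhs (+-monoˡ-< (- y + - x) x<y))
    where
    open SetoidReasoning setoid
    lhs : (x + (- y + - x)) ≈ (- y)
    lhs = begin
      x + (- y + - x) ≈⟨ +-comm x (- y + - x) ⟩
      (- y + - x) + x ≈⟨ //-rightDividesˡ x (- y) ⟩
      - y             ∎
    rhs : (y + (- y + - x)) ≈ (- x)
    rhs = begin
      y + (- y + - x) ≈⟨ +-assoc y (- y) (- x) ⟨
      (y - y) + - x   ≈⟨ +-congʳ (-‿inverseʳ y) ⟩
      0# + - x        ≈⟨ +-identityˡ (- x) ⟩
      - x             ∎

  near : ∀ {t s δ η} → δ ≤ η → (t - δ) < s → s < (t + δ) → (t - η) < s × s < (t + η)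
  near {t} {s} {δ} {η} (inj₁ δ<η) t-δ<s s<t+δ =
    <-trans (<-respˡ-≈ (+-comm (- η) t) (<-respʳ-≈ (+-comm (- δ) t) (+-monoˡ-< t (neg-mono δ<η)))) t-δ<s ,
    <-trans s<t+δ (<-respˡ-≈ (+-comm δ t) (<-respʳ-≈ (+-comm η t) (+-monoˡ-< t δ<η)))
  near (inj₂ δ≈η) t-δ<s s<t+δ =
    <-respˡ-≈ (+-congˡ (-‿cong δ≈η)) t-δ<s , <-respʳ-≈ (+-congˡ δ≈η) s<t+δ

  restrict : ∀ {a b a′ b′ f} → a ≤ a′ → b′ ≤ b → ContinuousOn[ a , b ] f → ContinuousOn[ a′ , b′ ] f
  restrict a≤a′ b′≤b cont t a′≤t t≤b′ ε 0<ε with cont t (≤-trans a≤a′ a′≤t) (≤-trans t≤b′ b′≤b) ε 0<ε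
  ... | δ , 0<δ , close = δ , 0<δ , λ s a′≤s s≤b′ →
          close s (≤-trans a≤a′ a′≤s) (≤-trans s≤b′ b′≤b)

  -- With `ε` half the gap at `t`, the values of `f` near `t` stay below the midpoint `f t + ε` and
  -- those of `g` above it.
  <-nearby : ∀ {a b f g} → ContinuousOn[ a , b ] f → ContinuousOn[ a , b ] g →
             ∀ {t} → a ≤ t → t ≤ b → f t < g t →
             ∃[ δ ] (0# < δ × (∀ {s} → a ≤ s → s ≤ b → (t - δ) < s → s < (t + δ) → f s < g s))
  <-nearby {a} {b} {f} {g} f-cont g-cont {t} a≤t t≤b ft<gt with half (0<y-x ft<gt)
  ... | ε , 0<ε , 2ε≈ with f-cont t a≤t t≤b ε 0<ε | g-cont t a≤t t≤b ε 0<ε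
  ...   | δ₁ , 0<δ₁ , f-close | δ₂ , 0<δ₂ , g-close with below-both δ₁ δ₂ 0<δ₁ 0<δ₂
  ...     | δ , 0<δ , δ≤δ₁ , δ≤δ₂ = δ , 0<δ , λ {s} a≤s s≤b t-δ<s s<t+δ →
    let p , q = near δ≤δ₁ t-δ<s s<t+δ
        p′ , q′ = near δ≤δ₂ t-δ<s s<t+δ
    in <-trans (proj₂ (f-close s a≤s s≤b p q))
               (<-respˡ-≈ (sym eq) (proj₁ (g-close s a≤s s≤b p′ q′)))
    where
    open SetoidReasoning setoid
    eq : (f t + ε) ≈ (g t - ε)
    eq = begin
      f t + ε               ≈⟨ //-rightDividesʳ ε (f t + ε) ⟨
      ((f t + ε) + ε) - ε   ≈⟨ +-congʳ (+-assoc (f t) ε ε) ⟩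
      (f t + (ε + ε)) - ε   ≈⟨ +-congʳ (+-congˡ 2ε≈) ⟩
      (f t + (g t - f t)) - ε ≈⟨ +-congʳ (+-comm (f t) (g t - f t)) ⟩
      ((g t - f t) + f t) - ε ≈⟨ +-congʳ (//-rightDividesˡ (f t) (g t)) ⟩
      g t - ε               ∎

  -- The crossing is the supremum of the points where f lies left of g.
  intermediate : ∀ {a b f g} → a < b →
                 ContinuousOn[ a , b ] f → ContinuousOn[ a , b ] g →
                 f a < g a → g b < f b → ∃[ t ] (a < t × t < b × f t ≈ g t)
  intermediate {a} {b} {f} {g} a<b f-cont g-cont fa<ga gb<fb
    with supremum S (a , ≤-refl , inj₁ a<b , fa<ga) (b , λ (_ , x≤b , _) → x≤b)
    where
    S : Carrier → Set
    S x = a ≤ x × x ≤ b × f x < g x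
  ... | s , upper , least = result
    where
    a≤s : a ≤ s
    a≤s = upper (≤-refl , inj₁ a<b , fa<ga)
    s≤b : s ≤ b
    s≤b = least b (λ (_ , x≤b , _) → x≤b)
    around : ∀ {x δ} → x ≈ s → 0# < δ → (s - δ) < x × x < (s + δ)
    around x≈s 0<δ = <-respʳ-≈ (sym x≈s) (x-ε<x 0<δ) , <-respˡ-≈ (sym x≈s) (x<x+ε 0<δ)
    -- Otherwise `f` would still be left of `g` slightly beyond `s`, or at `b` itself if `s ≈ b`.
    f≮g : ¬ (f s < g s)
    f≮g fs<gs with <-nearby f-cont g-cont a≤s s≤b fs<gs
    ... | δ , 0<δ , f<g with s≤b
    ...   | inj₂ s≈b = let p , q = around (sym s≈b) 0<δ in
                       asym gb<fb (f<g (inj₁ a<b) ≤-refl p q)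
    ...   | inj₁ s<b with between-below b (s + δ) s<b (x<x+ε 0<δ)
    ...     | w , s<w , w<b , w<s+δ =
              let a≤w = inj₁ (≤-<-trans a≤s s<w) in
              <⇒≱ s<w (upper (a≤w , inj₁ w<b , f<g a≤w (inj₁ w<b) (<-trans (x-ε<x 0<δ) s<w) w<s+δ))
    -- Otherwise no point of `S` exceeds `s - δ`, which would be a smaller upper bound.
    g≮f : ¬ (g s < f s)
    g≮f gs<fs with <-nearby g-cont f-cont a≤s s≤b gs<fs
    ... | δ , 0<δ , g<f = <⇒≱ (x-ε<x 0<δ) (least (s - δ) bound)
      where
      bound : ∀ {x} → a ≤ x × x ≤ b × f x < g x → x ≤ (s - δ)
      bound {x} x∈S@(a≤x , x≤b , fx<gx) with compare x (s - δ)
      ... | tri< x<s-δ _ _ = inj₁ x<s-δ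
      ... | tri≈ _ x≈s-δ _ = inj₂ x≈s-δ
      ... | tri> _ _ s-δ<x = contradiction fx<gx
              (asym (g<f a≤x x≤b s-δ<x (≤-<-trans (upper x∈S) (x<x+ε 0<δ))))
    fs≈gs : f s ≈ g s
    fs≈gs with compare (f s) (g s)
    ... | tri< fs<gs _ _ = contradiction fs<gs f≮g
    ... | tri≈ _ fs≈gs _ = fs≈gs
    ... | tri> _ _ gs<fs = contradiction gs<fs g≮f
    a<s : a < s
    a<s with a≤s
    ... | inj₁ a<s = a<s
    -- `f` and `g` are not assumed to respect `≈`; continuity at `a` carries `f a < g a` over to
    -- `s`.
    ... | inj₂ a≈s with <-nearby f-cont g-cont ≤-refl (inj₁ a<b) fa<ga
    ...   | δ , 0<δ , f<g = contradiction
            (f<g a≤s s≤b (<-respʳ-≈ a≈s (x-ε<x 0<δ)) (<-respˡ-≈ a≈s (x<x+ε 0<δ))) f≮g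
    s<b : s < b
    s<b with s≤b
    ... | inj₁ s<b = s<b
    ... | inj₂ s≈b with <-nearby g-cont f-cont (inj₁ a<b) ≤-refl gb<fb
    ...   | δ , 0<δ , g<f = contradiction
            (g<f a≤s s≤b (<-respʳ-≈ (sym s≈b) (x-ε<x 0<δ)) (<-respˡ-≈ (sym s≈b) (x<x+ε 0<δ))) g≮f
    result : ∃[ t ] (a < t × t < b × f t ≈ g t)
    result = s , a<s , s<b , fs≈gs

open import Data.Fin using (Fin; zero; suc; toℕ; fromℕ; inject₁)
import Data.Fin as Fin
import Data.Fin.Properties as Fin
open import Data.Fin.Permutation using (↔⇒≡)
open import Data.List using (List; []; _∷_; length; filter; map; _++_; allFin; cartesianProduct)
open import Data.List.Membership.Propositional using (_∈_)
open import Data.List.Membership.Propositional.Properties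
  using (∈-∃++; ∈-++⁺ˡ; ∈-++⁺ʳ; ∈-++⁻; ∈-filter⁺; ∈-filter⁻; ∈-map⁺; ∈-map⁻; ∈-allFin; ∈-cartesianProduct⁺)
open import Data.List.Properties using (length-++; length-map)
open import Data.List.Relation.Unary.All as All using (All; []; _∷_)
open import Data.List.Relation.Unary.Any using (here; there)
open import Data.List.Relation.Unary.Unique.Propositional using (Unique; []; _∷_)
import Data.List.Relation.Unary.Unique.Propositional.Properties as Unique
open import Data.Nat
  using (ℕ; zero; suc; pred; _+_; _*_; _≤_; _<_; _≤?_; _<?_; _≟_; z≤n; s≤s; z<s)
open import Data.Nat.Properties
open import Data.Nat.Tactic.RingSolver using (solve-∀)
open import Data.Product.Properties using (≡-dec)
open import Function using (_∘_; flip)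
open import Function.Bundles using (Inverse; Equivalence; mk⇔)
open import Function.Construct.Composition using (_↔-∘_)
open import Function.Construct.Symmetry using (↔-sym)
open import Relation.Binary.PropositionalEquality
  using (_≡_; _≢_; refl; sym; trans; cong; cong₂; subst; subst₂)
open import Relation.Nullary.Decidable using (_×-dec_; ¬?; decidable-stable; map′)
open import Relation.Unary using (Pred; Decidable)

-- Edges as lattice points

-- Each element of `xs` is matched with an occurrence in `ys` that is then deleted. The edge counts
-- below are compared by such inclusions.
length-⊆ : ∀ {A : Set} {xs ys : List A} → Unique xs → (∀ {x} → x ∈ xs → x ∈ ys) →
           length xs ≤ length ys
length-⊆ [] _ = z≤n
length-⊆ {xs = x ∷ xs} (x∉xs ∷ unique) sub with ∈-∃++ (sub (here refl))
... | as , bs , refl = begin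
    suc (length xs)             ≤⟨ s≤s (length-⊆ unique sub′) ⟩
    suc (length (as ++ bs))     ≡⟨ cong suc (length-++ as) ⟩
    suc (length as + length bs) ≡⟨ +-suc (length as) (length bs) ⟨
    length as + suc (length bs) ≡⟨ length-++ as ⟨
    length (as ++ x ∷ bs)       ∎
  where
  open ≤-Reasoning
  sub′ : ∀ {y} → y ∈ xs → y ∈ as ++ bs
  sub′ y∈xs with ∈-++⁻ as (sub (there y∈xs))
  ... | inj₁ y∈as         = ∈-++⁺ˡ y∈as
  ... | inj₂ (here refl)  = contradiction refl (All.lookup x∉xs y∈xs)
  ... | inj₂ (there y∈bs) = ∈-++⁺ʳ as y∈bs

Point : Set
Point = ℕ × ℕ

Cross : Point → Point → Set
Cross (a , b) (c , d) = (a < c × d < b) ⊎ (c < a × b < d)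

Cross-sym : ∀ e f → Cross e f → Cross f e
Cross-sym _ _ (inj₁ (p , q)) = inj₂ (p , q)
Cross-sym _ _ (inj₂ (p , q)) = inj₁ (p , q)

Cross-swap : ∀ e f → Cross (swap e) (swap f) → Cross e f
Cross-swap _ _ (inj₁ (p , q)) = inj₂ (q , p)
Cross-swap _ _ (inj₂ (p , q)) = inj₁ (q , p)

-- A 2-layer drawing up to the shape of its arcs: E c d says that the c-th
-- vertex of one layer is adjacent to the d-th vertex of the other one, where
-- (P , Q) is the pair of last vertices.
record Drawing : Set₁ where
  field
    E       : ℕ → ℕ → Set
    E?      : ∀ c d → Dec (E c d)
    P Q     : ℕ
    bounded : ∀ {c d} → E c d → c ≤ P × d ≤ Q

  Edge : Pred Point _
  Edge (c , d) = E c d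

  field
    crossed≤2 : ∀ {e f g h} → Edge e → Edge f → Edge g → Edge h →
                f ≢ g → f ≢ h → g ≢ h →
                Cross e f → Cross e g → ¬ Cross e h

-- Crossing is invariant under exchanging the layers, so each unsymmetric case is treated for one
-- layer only.
transpose : Drawing → Drawing
transpose D = record
  { E = flip E ; E? = flip E? ; P = Q ; Q = P
  ; bounded = λ e → swap (bounded e)
  ; crossed≤2 = λ {e} {f} {g} {h} Ee Ef Eg Eh f≢g f≢h g≢h ef eg eh →
      crossed≤2 Ee Ef Eg Eh (f≢g ∘ cong swap) (f≢h ∘ cong swap) (g≢h ∘ cong swap)
        (Cross-swap (swap e) (swap f) ef) (Cross-swap (swap e) (swap g) eg)
        (Cross-swap (swap e) (swap h) eh)
  }
  where open Drawing D

-- Shape a b is the shape of K₂,₃ with 1 + a and 1 + b vertices on the layers.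
data Shape : ℕ → ℕ → Set where
  2×3 : Shape 1 2
  3×2 : Shape 2 1

Shape-swap : ∀ {a b} → Shape a b → Shape b a
Shape-swap 2×3 = 3×2
Shape-swap 3×2 = 2×3

module _ (D : Drawing) where
  open Drawing D

  -- The edges to the right of (i , j) form a sequence of K₂,₃'s starting with
  -- the planar edge (i , j).
  data Bricks (i j : ℕ) : Set where
    end   : i ≡ P → j ≡ Q → E i j → Bricks i j
    brick : ∀ {a b} → Shape a b →
            (∀ {c d} → i ≤ c → c ≤ a + i → j ≤ d → d ≤ b + j → E c d) →
            (∀ {c d} → E c d → i ≤ c → j ≤ d →
               (a + i ≤ c × b + j ≤ d) ⊎ (c ≤ a + i × d ≤ b + j)) →
            Bricks (a + i) (b + j) → Bricks i j

  -- The edges right of (i , j) are those right of (i′ , j′) and some listed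
  -- ones, and the loss of listed edges is paid by the removed vertices.
  record Reduction (i j : ℕ) : Set where
    field
      i′ j′    : ℕ
      i′≤P     : i′ ≤ P
      j′≤Q     : j′ ≤ Q
      advances : i + j < i′ + j′
      removed  : List Point
      covers   : ∀ {c d} → E c d → i ≤ c → j ≤ d →
                 (i′ ≤ c × j′ ≤ d) ⊎ (c , d) ∈ removed
      gain     : 3 * length removed + 5 * (i + j) < 5 * (i′ + j′) ⊎
                 (3 * length removed + 5 * (i + j) ≡ 5 * (i′ + j′) ×
                  (Bricks i′ j′ → Bricks i j))

Bricks-swap : ∀ {D i j} → Bricks (transpose D) i j → Bricks D j i
Bricks-swap (end p q e) = end q p e
Bricks-swap (brick s full cover bs) =
  brick (Shape-swap s) (λ p q r s → full r s p q)
    (λ e p q → ⊎-map swap swap (cover e q p)) (Bricks-swap bs)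

-- The converse direction serves the premise of the implication between bricks inside `gain`.
Bricks-unswap : ∀ {D i j} → Bricks D j i → Bricks (transpose D) i j
Bricks-unswap (end p q e) = end q p e
Bricks-unswap (brick s full cover bs) =
  brick (Shape-swap s) (λ p q r s → full r s p q)
    (λ e p q → ⊎-map swap swap (cover e q p)) (Bricks-unswap bs)

Reduction-swap : ∀ {D i j} → Reduction (transpose D) i j → Reduction D j i
Reduction-swap {D} {i} {j} R = record
  { i′ = j′ ; j′ = i′ ; i′≤P = j′≤Q ; j′≤Q = i′≤P
  ; advances = subst₂ _<_ (+-comm i j) (+-comm i′ j′) advances
  ; removed = map swap removed
  ; covers = λ e p q → ⊎-map swap (∈-map⁺ swap) (covers e q p)
  ; gain = ⊎-map (subst₂ _<_ lhs rhs)
      (λ (eq , f) → trans (sym lhs) (trans eq rhs) , Bricks-swap ∘ f ∘ Bricks-unswap) gain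
  }
  where
  open Reduction R
  lhs : 3 * length removed + 5 * (i + j) ≡ 3 * length (map swap removed) + 5 * (j + i)
  lhs = cong₂ (λ x y → 3 * x + 5 * y) (sym (length-map swap removed)) (+-comm i j)
  rhs : 5 * (i′ + j′) ≡ 5 * (j′ + i′)
  rhs = cong (5 *_) (+-comm i′ j′)

-- Case analysis at the leftmost pair

data Occurrences (S : ℕ → Set) : Set where
  none : (∀ {d} → ¬ S d) → Occurrences S
  one  : ∀ x → S x → (∀ {d} → S d → d ≡ x) → Occurrences S
  many : ∀ x y → x < y → S x → S y → Occurrences S

find? : ∀ {S : ℕ → Set} → Decidable S → ∀ N → (∀ {d} → S d → d ≤ N) → Dec (∃[ d ] S d)
find? S? N S≤N = map′ (λ (d , _ , s) → d , s) (λ (d , s) → d , s≤s (S≤N s) , s)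
                      (anyUpTo? S? (suc N))

occurrences : ∀ {S : ℕ → Set} → Decidable S → ∀ N → (∀ {d} → S d → d ≤ N) → Occurrences S
occurrences S? N S≤N with find? S? N S≤N
... | no ¬s = none (λ s → ¬s (_ , s))
... | yes (x , Sx) with find? (λ d → S? d ×-dec (¬? (d ≟ x))) N (S≤N ∘ proj₁)
...   | no ¬s = one x Sx λ {d} s → decidable-stable (d ≟ x) (λ d≢x → ¬s (d , s , d≢x))
...   | yes (y , Sy , y≢x) with <-cmp x y
...     | tri< x<y _ _ = many x y x<y Sx Sy
...     | tri≈ _ x≡y _ = contradiction (sym x≡y) y≢x
...     | tri> _ _ y<x = many y x y<x Sy Sx

advance : ∀ a b i j {i′ j′} → a + i ≤ i′ → b + j ≤ j′ → (a + b) + (i + j) ≤ i′ + j′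
advance a b i j {i′} {j′} p q = begin
  (a + b) + (i + j) ≡⟨ lemma a b i j ⟩
  (a + i) + (b + j) ≤⟨ +-mono-≤ p q ⟩
  i′ + j′           ∎
  where
  open ≤-Reasoning
  lemma : ∀ a b i j → (a + b) + (i + j) ≡ (a + i) + (b + j)
  lemma = solve-∀

-- `a` and `b` are lower bounds for the vertices passed on the two layers. Passing more only helps,
-- so each case reduces to comparing two numerals.
gain< : ∀ k a b i j {i′ j′} → a + i ≤ i′ → b + j ≤ j′ → 3 * k < 5 * (a + b) →
        3 * k + 5 * (i + j) < 5 * (i′ + j′)
gain< k a b i j {i′} {j′} p q 3k< = begin-strict
  3 * k + 5 * (i + j)       <⟨ +-monoˡ-< (5 * (i + j)) 3k< ⟩
  5 * (a + b) + 5 * (i + j) ≡⟨ *-distribˡ-+ 5 (a + b) (i + j) ⟨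
  5 * ((a + b) + (i + j))   ≤⟨ *-monoʳ-≤ 5 (advance a b i j p q) ⟩
  5 * (i′ + j′)             ∎
  where open ≤-Reasoning

<⇒≢₁ : ∀ {a b c d : ℕ} → a < c → (a , b) ≢ (c , d)
<⇒≢₁ a<c refl = <-irrefl refl a<c

<⇒≢₂ : ∀ {a b c d : ℕ} → b < d → (a , b) ≢ (c , d)
<⇒≢₂ b<d refl = <-irrefl refl b<d

module _ (D : Drawing) {i j : ℕ} (i≤P : i ≤ Drawing.P D) (j≤Q : j ≤ Drawing.Q D) where
  open Drawing D

  -- The further edges at the two leftmost vertices are the row and the column through the lattice
  -- point `(i , j)`.
  Row Column : ℕ → Set
  Row d    = j < d × E i d
  Column c = i < c × E c j

  row : Occurrences Row
  row = occurrences (λ d → (j <? d) ×-dec E? i d) Q (proj₂ ∘ bounded ∘ proj₂)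

  column : Occurrences Column
  column = occurrences (λ c → (i <? c) ×-dec E? c j) P (proj₁ ∘ bounded ∘ proj₂)

  row-crosses-column : ∀ {c d} → Row d → Column c → Cross (i , d) (c , j)
  row-crosses-column (j<d , _) (i<c , _) = inj₁ (i<c , j<d)

  empty-column-< : (∀ {c} → ¬ Column c) → j < Q → Reduction D i j
  empty-column-< empty j<Q = record
    { i′ = i ; j′ = suc j ; i′≤P = i≤P ; j′≤Q = j<Q
    ; advances = advance 0 1 i j ≤-refl ≤-refl
    ; removed = (i , j) ∷ []
    ; covers = covers
    ; gain = inj₁ (gain< 1 0 1 i j ≤-refl ≤-refl (<ᵇ⇒< 3 5 _))
    }
    where
    covers : ∀ {c d} → E c d → i ≤ c → j ≤ d → (i ≤ c × j < d) ⊎ (c , d) ∈ (i , j) ∷ []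
    covers e i≤c j≤d with m≤n⇒m<n∨m≡n j≤d
    ... | inj₁ j<d = inj₁ (i≤c , j<d)
    ... | inj₂ refl with m≤n⇒m<n∨m≡n i≤c
    ...   | inj₁ i<c  = contradiction (i<c , e) empty
    ...   | inj₂ refl = inj₂ (here refl)

  -- When `j` is the last vertex of its layer, `i` is dropped instead: with nothing beyond `j`, its
  -- only possible edge to the right is `(i , j)`.
  empty-row-= : i < P → j ≡ Q → Reduction D i j
  empty-row-= i<P refl = record
    { i′ = suc i ; j′ = j ; i′≤P = i<P ; j′≤Q = j≤Q
    ; advances = advance 1 0 i j ≤-refl ≤-refl
    ; removed = (i , j) ∷ []
    ; covers = covers
    ; gain = inj₁ (gain< 1 1 0 i j ≤-refl ≤-refl (<ᵇ⇒< 3 5 _))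
    }
    where
    covers : ∀ {c d} → E c d → i ≤ c → j ≤ d → (i < c × j ≤ d) ⊎ (c , d) ∈ (i , j) ∷ []
    covers e i≤c j≤d with m≤n⇒m<n∨m≡n i≤c | ≤-antisym j≤d (proj₂ (bounded e))
    ... | inj₁ i<c  | _    = inj₁ (i<c , j≤d)
    ... | inj₂ refl | refl = inj₂ (here refl)

  empty-column : (∀ {c} → ¬ Column c) → i < P ⊎ j < Q → Reduction D i j
  empty-column empty i<P⊎j<Q with m≤n⇒m<n∨m≡n j≤Q | i<P⊎j<Q
  ... | inj₁ j<Q | _        = empty-column-< empty j<Q
  ... | inj₂ j≡Q | inj₁ i<P = empty-row-= i<P j≡Q
  ... | inj₂ j≡Q | inj₂ j<Q = contradiction j≡Q (<⇒≢ j<Q)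

  one-one : ∀ x → Row x → (∀ {d} → Row d → d ≡ x) →
            ∀ y → Column y → (∀ {c} → Column c → c ≡ y) → Reduction D i j
  one-one x (j<x , Eix) row≡x y (i<y , Eyj) column≡y = record
    { i′ = suc i ; j′ = suc j
    -- The further neighbours `y` and `x` ensure that neither `i` nor `j` is the last vertex of its
    -- layer.
    ; i′≤P = ≤-trans i<y (proj₁ (bounded Eyj)) ; j′≤Q = ≤-trans j<x (proj₂ (bounded Eix))
    ; advances = <-trans (n<1+n _) (advance 1 1 i j ≤-refl ≤-refl)
    ; removed = es
    ; covers = covers
    ; gain = inj₁ (gain< 3 1 1 i j ≤-refl ≤-refl (<ᵇ⇒< 9 10 _))
    }
    where
    es : List Point
    es = (i , j) ∷ (i , x) ∷ (y , j) ∷ []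
    covers : ∀ {c d} → E c d → i ≤ c → j ≤ d → (i < c × j < d) ⊎ (c , d) ∈ es
    covers e i≤c j≤d with m≤n⇒m<n∨m≡n i≤c | m≤n⇒m<n∨m≡n j≤d
    ... | inj₁ i<c  | inj₁ j<d  = inj₁ (i<c , j<d)
    ... | inj₂ refl | inj₂ refl = inj₂ (here refl)
    ... | inj₂ refl | inj₁ j<d  = inj₂ (there (here (cong (i ,_) (row≡x (j<d , e)))))
    ... | inj₁ i<c  | inj₂ refl = inj₂ (there (there (here (cong (_, j) (column≡y (i<c , e))))))

  -- An edge in column j is crossed by both row edges, hence by no further one.
  module TwoInRow {x₁ x₂} (x₁<x₂ : x₁ < x₂) (R₁ : Row x₁) (R₂ : Row x₂) where

    saturated : ∀ {y c d} → Column y → E c d → (c , d) ≢ (i , x₁) → (c , d) ≢ (i , x₂) →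
                ¬ Cross (y , j) (c , d)
    saturated C e ≢₁ ≢₂ cross =
      crossed≤2 (proj₂ C) (proj₂ R₁) (proj₂ R₂) e
        (<⇒≢₂ x₁<x₂) (≢₁ ∘ sym) (≢₂ ∘ sym)
        (Cross-sym _ _ (row-crosses-column R₁ C)) (Cross-sym _ _ (row-crosses-column R₂ C))
        cross

    -- An edge with `c < y` would be a third one crossing `(y , j)`.
    beyond-column : ∀ {y c d} → Column y → E c d → i < c → j < d → y ≤ c
    beyond-column C e i<c j<d = ≮⇒≥ λ c<y →
      saturated C e (<⇒≢₁ i<c ∘ sym) (<⇒≢₁ i<c ∘ sym) (inj₂ (c<y , j<d))

    -- A third row edge, which `many` leaves open, would also cross the saturated `(y , j)`.
    row-cases : ∀ {y d} → Column y → Row d → d ≡ x₁ ⊎ d ≡ x₂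
    row-cases {y} {d} C R with d ≟ x₁ | d ≟ x₂
    ... | yes d≡x₁ | _        = inj₁ d≡x₁
    ... | no _     | yes d≡x₂ = inj₂ d≡x₂
    ... | no d≢x₁  | no d≢x₂  = contradiction (Cross-sym _ _ (row-crosses-column R C))
      (saturated C (proj₂ R) (d≢x₁ ∘ cong proj₂) (d≢x₂ ∘ cong proj₂))

module _ (D : Drawing) {i j : ℕ} (i≤P : i ≤ Drawing.P D) (j≤Q : j ≤ Drawing.Q D) where
  open Drawing D

  -- Saturation applies in both directions and pushes all unlisted edges beyond `y₂` and beyond
  -- `x₂`. On each layer at least the corner and the nearer further neighbour are passed.
  two-two : ∀ {x₁ x₂} → x₁ < x₂ → Row D i≤P j≤Q x₁ → Row D i≤P j≤Q x₂ →
            ∀ {y₁ y₂} → y₁ < y₂ → Column D i≤P j≤Q y₁ → Column D i≤P j≤Q y₂ →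
            Reduction D i j
  two-two {x₁} {x₂} x₁<x₂ R₁ R₂ {y₁} {y₂} y₁<y₂ C₁ C₂ = record
    { i′ = y₂ ; j′ = x₂
    ; i′≤P = proj₁ (bounded (proj₂ C₂)) ; j′≤Q = proj₂ (bounded (proj₂ R₂))
    ; advances = ≤-trans (m≤n+m _ 3) (advance 2 2 i j 2+i≤y₂ 2+j≤x₂)
    ; removed = es
    ; covers = covers
    ; gain = inj₁ (gain< 5 2 2 i j 2+i≤y₂ 2+j≤x₂ (<ᵇ⇒< 15 20 _))
    }
    where
    module H = TwoInRow D i≤P j≤Q x₁<x₂ R₁ R₂
    module V = TwoInRow (transpose D) j≤Q i≤P y₁<y₂ C₁ C₂
    es : List Point
    es = (i , j) ∷ (i , x₁) ∷ (i , x₂) ∷ (y₁ , j) ∷ (y₂ , j) ∷ []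
    2+i≤y₂ : 2 + i ≤ y₂
    2+i≤y₂ = ≤-trans (s≤s (proj₁ C₁)) y₁<y₂
    2+j≤x₂ : 2 + j ≤ x₂
    2+j≤x₂ = ≤-trans (s≤s (proj₁ R₁)) x₁<x₂
    covers : ∀ {c d} → E c d → i ≤ c → j ≤ d → (y₂ ≤ c × x₂ ≤ d) ⊎ (c , d) ∈ es
    covers e i≤c j≤d with m≤n⇒m<n∨m≡n i≤c | m≤n⇒m<n∨m≡n j≤d
    ... | inj₁ i<c  | inj₁ j<d  = inj₁ (H.beyond-column C₂ e i<c j<d , V.beyond-column R₂ e j<d i<c)
    ... | inj₂ refl | inj₂ refl = inj₂ (here refl)
    ... | inj₂ refl | inj₁ j<d with H.row-cases C₁ (j<d , e)
    ...   | inj₁ refl = inj₂ (there (here refl))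
    ...   | inj₂ refl = inj₂ (there (there (here refl)))
    covers e i≤c j≤d | inj₁ i<c | inj₂ refl with V.row-cases R₁ (i<c , e)
    ...   | inj₁ refl = inj₂ (there (there (there (here refl))))
    ...   | inj₂ refl = inj₂ (there (there (there (there (here refl)))))

  module TwoOne {x₁ x₂} (x₁<x₂ : x₁ < x₂) (R₁ : Row D i≤P j≤Q x₁) (R₂ : Row D i≤P j≤Q x₂)
                {y} (C : Column D i≤P j≤Q y) (column≡y : ∀ {c} → Column D i≤P j≤Q c → c ≡ y) where
    open TwoInRow D i≤P j≤Q x₁<x₂ R₁ R₂

    1+i≤y : 1 + i ≤ y
    1+i≤y = proj₁ C

    1+j≤x₁ : 1 + j ≤ x₁
    1+j≤x₁ = proj₁ R₁

    2+j≤x₂ : 2 + j ≤ x₂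
    2+j≤x₂ = ≤-trans (s≤s 1+j≤x₁) x₁<x₂

    known : List Point
    known = (i , x₁) ∷ (i , x₂) ∷ (y , j) ∷ []

    -- Among the edges right of `(i , j)`, these are the ones outside column `j` that cross the
    -- longer row edge `(i , x₂)`.
    Extra : Point → Set
    Extra (c , d) = i < c × j < d × d < x₂ × E c d

    extra? : Dec (∃[ e ] Extra e)
    extra? = map′ (λ (c , d , e) → (c , d) , e) (λ ((c , d) , e) → c , d , e)
      (find? (λ c → find? (λ d → (i <? c) ×-dec (j <? d) ×-dec (d <? x₂) ×-dec E? c d)
                           Q (λ (_ , _ , _ , e) → proj₂ (bounded e)))
             P (λ (_ , _ , _ , _ , e) → proj₁ (bounded e)))

    -- `(i , x₂)` is already crossed by `(y , j)`, which leaves room for one more crossing.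
    extra-unique : ∀ {e f} → Extra e → Extra f → e ≡ f
    extra-unique {e} {f} (i<c , j<d , d<x₂ , Ee) (i<c′ , j<d′ , d′<x₂ , Ef) =
      decidable-stable (≡-dec _≟_ _≟_ e f) λ e≢f →
        crossed≤2 (proj₂ R₂) (proj₂ C) Ee Ef (<⇒≢₂ j<d) (<⇒≢₂ j<d′) e≢f
          (row-crosses-column D i≤P j≤Q R₂ C) (inj₁ (i<c , d<x₂)) (inj₁ (i<c′ , d′<x₂))

    data Position (c d : ℕ) : Set where
      corner  : (c , d) ≡ (i , j) → Position c d
      listed  : (c , d) ∈ known → Position c d
      extra   : Extra (c , d) → Position c d
      further : y ≤ c → x₂ ≤ d → Position c d

    position : ∀ {c d} → E c d → i ≤ c → j ≤ d → Position c d
    position {c} {d} e i≤c j≤d with m≤n⇒m<n∨m≡n i≤c | m≤n⇒m<n∨m≡n j≤d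
    ... | inj₂ refl | inj₂ refl = corner refl
    ... | inj₁ i<c  | inj₂ refl = listed (there (there (here (cong (_, j) (column≡y (i<c , e))))))
    ... | inj₂ refl | inj₁ j<d with row-cases C (j<d , e)
    ...   | inj₁ refl = listed (here refl)
    ...   | inj₂ refl = listed (there (here refl))
    position {c} {d} e i≤c j≤d | inj₁ i<c  | inj₁ j<d with d <? x₂
    ...   | yes d<x₂ = extra (i<c , j<d , d<x₂ , e)
    ...   | no d≮x₂  = further (beyond-column C e i<c j<d) (≮⇒≥ d≮x₂)

    -- The corner and the extra edge may each be absent. Passing them as lists of length 0 or 1 lets
    -- all four cases share one argument while the number of removed edges stays exact.
    reduce : (corners extras : List Point) →
      (E i j → (i , j) ∈ corners) → (∀ {e} → Extra e → e ∈ extras) →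
      let k = length (corners ++ known ++ extras) in
      3 * k + 5 * (i + j) < 5 * (y + x₂) ⊎
      (3 * k + 5 * (i + j) ≡ 5 * (y + x₂) × (Bricks D y x₂ → Bricks D i j)) →
      Reduction D i j
    reduce corners extras ∈corners ∈extras gain = record
      { i′ = y ; j′ = x₂
      ; i′≤P = proj₁ (bounded (proj₂ C)) ; j′≤Q = proj₂ (bounded (proj₂ R₂))
      ; advances = ≤-trans (m≤n+m _ 2) (advance 1 2 i j 1+i≤y 2+j≤x₂)
      ; removed = corners ++ known ++ extras ; covers = covers ; gain = gain
      }
      where
      covers : ∀ {c d} → E c d → i ≤ c → j ≤ d →
               (y ≤ c × x₂ ≤ d) ⊎ (c , d) ∈ corners ++ known ++ extras
      covers e i≤c j≤d with position e i≤c j≤d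
      ... | corner refl = inj₂ (∈-++⁺ˡ (∈corners e))
      ... | listed ∈k   = inj₂ (∈-++⁺ʳ corners (∈-++⁺ˡ ∈k))
      ... | extra x     = inj₂ (∈-++⁺ʳ corners (∈-++⁺ʳ known (∈extras x)))
      ... | further p q = inj₁ (p , q)

    -- (y , x₂) = (1 + i , 2 + j) in the tight case.  There, an extra edge in a
    -- later row than y would be crossed by (y , x₂), (i , x₂) and an edge of
    -- the next brick.
    extra-in-row : ∀ {c d} → Extra (c , d) → y ≤ c → Bricks D y x₂ → c ≡ y
    extra-in-row (_ , _ , _ , Ecd) y≤c (end refl _ _) = ≤-antisym (proj₁ (bounded Ecd)) y≤c
    extra-in-row {c} {d} (i<c , _ , d<x₂ , Ecd) y≤c (brick {a} {b} s full _ _)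
      with m≤n⇒m<n∨m≡n y≤c
    ... | inj₂ y≡c = sym y≡c
    ... | inj₁ y<c = contradiction (inj₂ (y<c , ≤-trans d<x₂ (n≤1+n x₂)))
      (crossed≤2 Ecd (proj₂ R₂)
        (full ≤-refl (m≤n+m y a) ≤-refl (m≤n+m x₂ b))
        (full ≤-refl (m≤n+m y a) (n≤1+n x₂) (+-monoˡ-≤ x₂ (1≤b s)))
        (<⇒≢₁ 1+i≤y) (<⇒≢₁ 1+i≤y) (<⇒≢₂ (n<1+n x₂))
        (inj₂ (i<c , d<x₂)) (inj₂ (y<c , d<x₂)))
      where
      1≤b : ∀ {a b} → Shape a b → 1 ≤ b
      1≤b 2×3 = s≤s z≤n
      1≤b 3×2 = s≤s z≤n

    -- The five removed edges and the corner `(y , x₂)` of the following bricks are the six edges of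
    -- a K₂,₃ on rows `i`, `1 + i` and columns `j`, `1 + j`, `2 + j`.
    new-brick : E i j → ∃[ e ] Extra e → y ≡ 1 + i → x₂ ≡ 2 + j →
                Bricks D y x₂ → Bricks D i j
    new-brick Eij ((c₀ , d₀) , x₀@(i<c₀ , j<d₀ , d₀<x₂ , E₀)) refl refl bs =
      brick 2×3 full cover bs
      where
      x₁≡ : x₁ ≡ 1 + j
      x₁≡ = ≤-antisym (≤-pred x₁<x₂) 1+j≤x₁
      -- The extra edge has no other place: its row is `1 + i` by `extra-in-row`, and its column
      -- lies strictly between `j` and `2 + j`.
      middle : E (1 + i) (1 + j)
      middle = subst₂ E (extra-in-row x₀ (beyond-column C E₀ i<c₀ j<d₀) bs)
                        (≤-antisym (≤-pred d₀<x₂) j<d₀) E₀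
      far : ∀ {i j} → Bricks D i j → E i j
      far (end _ _ e) = e
      far (brick s full _ _) = full ≤-refl (m≤n+m _ _) ≤-refl (m≤n+m _ _)
      full : ∀ {c d} → i ≤ c → c ≤ 1 + i → j ≤ d → d ≤ 2 + j → E c d
      full p q r s with m≤n⇒m<n∨m≡n p | m≤n⇒m<n∨m≡n r
      ... | inj₂ refl | inj₂ refl = Eij
      ... | inj₁ i<c | inj₂ refl with ≤-antisym q i<c
      ...   | refl = proj₂ C
      full p q r s | inj₂ refl | inj₁ j<d with m≤n⇒m<n∨m≡n j<d
      ...   | inj₂ refl = subst (E i) x₁≡ (proj₂ R₁)
      ...   | inj₁ 1+j<d with ≤-antisym s 1+j<d
      ...     | refl = proj₂ R₂
      full p q r s | inj₁ i<c | inj₁ j<d with ≤-antisym q i<c | m≤n⇒m<n∨m≡n j<d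
      ...   | refl | inj₂ refl = middle
      ...   | refl | inj₁ 1+j<d with ≤-antisym s 1+j<d
      ...     | refl = far bs
      cover : ∀ {c d} → E c d → i ≤ c → j ≤ d →
              (1 + i ≤ c × 2 + j ≤ d) ⊎ (c ≤ 1 + i × d ≤ 2 + j)
      cover e i≤c j≤d with position e i≤c j≤d
      ... | corner refl                      = inj₂ (n≤1+n i , m≤n+m j 2)
      ... | listed (here refl)                = inj₂ (n≤1+n i , <⇒≤ x₁<x₂)
      ... | listed (there (here refl))         = inj₂ (n≤1+n i , ≤-refl)
      ... | listed (there (there (here refl))) = inj₂ (≤-refl , m≤n+m j 2)
      ... | further p q                      = inj₁ (p , q)
      ... | extra x@(i<c , j<d , d<x₂ , _)    =
        inj₂ (≤-reflexive (extra-in-row x (beyond-column C e i<c j<d) bs) , <⇒≤ d<x₂)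

    two-one : Reduction D i j
    two-one with E? i j | extra?
    ... | no ¬Eij | no ¬extra = reduce [] [] (λ e → contradiction e ¬Eij)
      (λ x → contradiction (_ , x) ¬extra)
      (inj₁ (gain< 3 1 2 i j 1+i≤y 2+j≤x₂ (<ᵇ⇒< 9 15 _)))
    ... | no ¬Eij | yes (e₀ , x₀) = reduce [] (e₀ ∷ []) (λ e → contradiction e ¬Eij)
      (λ x → here (extra-unique x x₀))
      (inj₁ (gain< 4 1 2 i j 1+i≤y 2+j≤x₂ (<ᵇ⇒< 12 15 _)))
    ... | yes _ | no ¬extra = reduce ((i , j) ∷ []) [] (λ _ → here refl)
      (λ x → contradiction (_ , x) ¬extra)
      (inj₁ (gain< 4 1 2 i j 1+i≤y 2+j≤x₂ (<ᵇ⇒< 12 15 _)))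
    ... | yes Eij | yes (e₀ , x₀) = reduce ((i , j) ∷ []) (e₀ ∷ []) (λ _ → here refl)
      (λ x → here (extra-unique x x₀)) gain
      where
      lemma : ∀ i j → 15 + 5 * (i + j) ≡ 5 * ((1 + i) + (2 + j))
      lemma = solve-∀
      gain : 3 * 5 + 5 * (i + j) < 5 * (y + x₂) ⊎
             (3 * 5 + 5 * (i + j) ≡ 5 * (y + x₂) × (Bricks D y x₂ → Bricks D i j))
      -- Five edges cost 15, exactly the worth of three vertices. One more passed vertex on either
      -- layer makes the gain strict.
      gain with m≤n⇒m<n∨m≡n 1+i≤y | m≤n⇒m<n∨m≡n 2+j≤x₂
      ... | inj₁ 2+i≤y | _          = inj₁ (gain< 5 2 2 i j 2+i≤y 2+j≤x₂ (<ᵇ⇒< 15 20 _))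
      ... | inj₂ _     | inj₁ 3+j≤x₂ = inj₁ (gain< 5 1 3 i j 1+i≤y 3+j≤x₂ (<ᵇ⇒< 15 20 _))
      ... | inj₂ 1+i≡y | inj₂ 2+j≡x₂ =
        inj₂ (trans (lemma i j) (cong (5 *_) (cong₂ _+_ 1+i≡y 2+j≡x₂)) ,
              new-brick Eij (e₀ , x₀) (sym 1+i≡y) (sym 2+j≡x₂))

module _ (D : Drawing) {i j : ℕ} (i≤P : i ≤ Drawing.P D) (j≤Q : j ≤ Drawing.Q D) where
  open Drawing D

  reduction : i < P ⊎ j < Q → Reduction D i j
  reduction i<P⊎j<Q with row D i≤P j≤Q | column D i≤P j≤Q
  ... | _ | none ¬c = empty-column D i≤P j≤Q ¬c i<P⊎j<Q
  ... | none ¬r | _ =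
    Reduction-swap (empty-column (transpose D) j≤Q i≤P ¬r (⊎-swap i<P⊎j<Q))
  ... | one x Rx R≡x | one y Cy C≡y = one-one D i≤P j≤Q x Rx R≡x y Cy C≡y
  ... | many _ _ x₁<x₂ R₁ R₂ | one _ C C≡y = TwoOne.two-one D i≤P j≤Q x₁<x₂ R₁ R₂ C C≡y
  ... | one _ R R≡x | many _ _ y₁<y₂ C₁ C₂ =
    Reduction-swap (TwoOne.two-one (transpose D) j≤Q i≤P y₁<y₂ C₁ C₂ R R≡x)
  ... | many _ _ x₁<x₂ R₁ R₂ | many _ _ y₁<y₂ C₁ C₂ =
    two-two D i≤P j≤Q x₁<x₂ R₁ R₂ y₁<y₂ C₁ C₂

-- The edge bound by induction

module _ (D : Drawing) where
  open Drawing D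

  Within : ℕ → ℕ → Pred Point _
  Within i j (c , d) = E c d × i ≤ c × j ≤ d

  -- The subtraction-free form of `3m ≤ 5n - 7` for the `n = (P - i + 1) + (Q - j + 1)` vertices
  -- from `(i , j)` on. The equality case travels through the same induction.
  Bound : ℕ → ℕ → List Point → Set
  Bound i j es = 3 * length es + 5 * (i + j) ≤ 5 * (P + Q) + 3 ×
                 (3 * length es + 5 * (i + j) ≡ 5 * (P + Q) + 3 → Bricks D i j)

  -- Only the edge `(P , Q)` can be left. Without it there is a slack of 3, so equality forces it to
  -- be present.
  bound-at-end : ∀ {es} → Unique es → All (Within P Q) es → Bound P Q es
  bound-at-end {[]} _ _ =
    m≤m+n _ 3 , λ eq → contradiction eq (<⇒≢ (m<m+n _ z<s))
  bound-at-end {e ∷ es} unique within@((Ee , P≤c , Q≤d) ∷ _) =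
    ≤-trans (+-monoˡ-≤ _ (*-monoʳ-≤ 3 (length-⊆ unique only))) (≤-reflexive (+-comm 3 _)) ,
    λ _ → end refl refl (subst₂ E (≤-antisym (proj₁ (bounded Ee)) P≤c)
                                  (≤-antisym (proj₂ (bounded Ee)) Q≤d) Ee)
    where
    only : ∀ {f} → f ∈ e ∷ es → f ∈ (P , Q) ∷ []
    only f∈ with All.lookup within f∈
    ... | Ef , P≤c , Q≤d = here (cong₂ _,_ (≤-antisym (proj₁ (bounded Ef)) P≤c)
                                           (≤-antisym (proj₂ (bounded Ef)) Q≤d))

  -- The edges beyond `(i′ , j′)` are counted by `rec` and the others are among `removed`. A strict
  -- gain rules out equality.
  bound-step : ∀ {i j} (r : Reduction D i j) → let open Reduction r in
               (∀ {fs} → Unique fs → All (Within i′ j′) fs → Bound i′ j′ fs) →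
               ∀ {es} → Unique es → All (Within i j) es → Bound i j es
  bound-step {i} {j} r rec {es} unique within = ≤-bound gain , ≡-bound gain
    where
    open Reduction r
    open ≤-Reasoning
    beyond? : Decidable (λ (c , d) → i′ ≤ c × j′ ≤ d)
    beyond? (c , d) = (i′ ≤? c) ×-dec (j′ ≤? d)
    fs : List Point
    fs = filter beyond? es
    Gain : Set
    Gain = 3 * length removed + 5 * (i + j) < 5 * (i′ + j′) ⊎
           (3 * length removed + 5 * (i + j) ≡ 5 * (i′ + j′) ×
            (Bricks D i′ j′ → Bricks D i j))
    IH : Bound i′ j′ fs
    IH = rec (Unique.filter⁺ beyond? unique) (All.tabulate λ f∈ →
      let f∈es , p , q = ∈-filter⁻ beyond? f∈ in proj₁ (All.lookup within f∈es) , p , q)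
    sub : ∀ {e} → e ∈ es → e ∈ fs ++ removed
    sub e∈ with All.lookup within e∈
    ... | Ee , p , q with covers Ee p q
    ...   | inj₁ b   = ∈-++⁺ˡ (∈-filter⁺ beyond? e∈ b)
    ...   | inj₂ e∈r = ∈-++⁺ʳ fs e∈r
    lemma : ∀ f r s → 3 * (f + r) + s ≡ 3 * f + (3 * r + s)
    lemma = solve-∀
    split : 3 * length es + 5 * (i + j) ≤ 3 * length fs + (3 * length removed + 5 * (i + j))
    split = begin
      3 * length es + 5 * (i + j)                            ≤⟨ +-monoˡ-≤ _ (*-monoʳ-≤ 3 (length-⊆ unique sub)) ⟩
      3 * length (fs ++ removed) + 5 * (i + j)               ≡⟨ cong (λ l → 3 * l + 5 * (i + j)) (length-++ fs) ⟩
      3 * (length fs + length removed) + 5 * (i + j)         ≡⟨ lemma (length fs) (length removed) _ ⟩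
      3 * length fs + (3 * length removed + 5 * (i + j))     ∎
    strict-bound : 3 * length removed + 5 * (i + j) < 5 * (i′ + j′) →
             3 * length es + 5 * (i + j) < 5 * (P + Q) + 3
    strict-bound gain< = begin-strict
      3 * length es + 5 * (i + j)                        ≤⟨ split ⟩
      3 * length fs + (3 * length removed + 5 * (i + j)) <⟨ +-monoʳ-< (3 * length fs) gain< ⟩
      3 * length fs + 5 * (i′ + j′)                      ≤⟨ proj₁ IH ⟩
      5 * (P + Q) + 3                                    ∎
    weak : 3 * length removed + 5 * (i + j) ≡ 5 * (i′ + j′) →
           3 * length es + 5 * (i + j) ≤ 3 * length fs + 5 * (i′ + j′)
    weak gain≡ = ≤-trans split (≤-reflexive (cong (3 * length fs +_) gain≡))
    ≤-bound : Gain → 3 * length es + 5 * (i + j) ≤ 5 * (P + Q) + 3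
    ≤-bound (inj₁ gain<)       = <⇒≤ (strict-bound gain<)
    ≤-bound (inj₂ (gain≡ , _)) = ≤-trans (weak gain≡) (proj₁ IH)
    ≡-bound : Gain → 3 * length es + 5 * (i + j) ≡ 5 * (P + Q) + 3 → Bricks D i j
    ≡-bound (inj₁ gain<)          eq = contradiction eq (<⇒≢ (strict-bound gain<))
    ≡-bound (inj₂ (gain≡ , grow)) eq =
      -- Equality at `(i , j)` with a tight gain squeezes the inductive bound into an equality.
      grow (proj₂ IH (≤-antisym (proj₁ IH) (≤-trans (≤-reflexive (sym eq)) (weak gain≡))))

  -- The recursion is on `m`, which bounds `(P + Q) - (i + j)`; every reduction increases `i + j`.
  bound : ∀ m {i j} → i ≤ P → j ≤ Q → P + Q ≤ m + (i + j) →
          ∀ {es} → Unique es → All (Within i j) es → Bound i j es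
  advance-bound : ∀ m {i j} → i ≤ P → j ≤ Q → P + Q ≤ m + (i + j) → i < P ⊎ j < Q →
                  ∀ {es} → Unique es → All (Within i j) es → Bound i j es

  bound m i≤P j≤Q fuel with m≤n⇒m<n∨m≡n i≤P | m≤n⇒m<n∨m≡n j≤Q
  ... | inj₂ refl | inj₂ refl = bound-at-end
  ... | inj₁ i<P  | _         = advance-bound m i≤P j≤Q fuel (inj₁ i<P)
  ... | inj₂ _    | inj₁ j<Q  = advance-bound m i≤P j≤Q fuel (inj₂ j<Q)

  advance-bound zero i≤P j≤Q fuel (inj₁ i<P) = contradiction fuel (<⇒≱ (+-mono-<-≤ i<P j≤Q))
  advance-bound zero i≤P j≤Q fuel (inj₂ j<Q) = contradiction fuel (<⇒≱ (+-mono-≤-< i≤P j<Q))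
  advance-bound (suc m) {i} {j} i≤P j≤Q fuel lt =
    bound-step r (bound m i′≤P j′≤Q (begin
      P + Q             ≤⟨ fuel ⟩
      suc m + (i + j)   ≡⟨ +-suc m (i + j) ⟨
      m + suc (i + j)   ≤⟨ +-monoʳ-≤ m advances ⟩
      m + (i′ + j′)     ∎))
    where
    r : Reduction D i j
    r = reduction D i≤P j≤Q lt
    open Reduction r
    open ≤-Reasoning

-- Reading off the sequence of bricks

module _ {D : Drawing} where
  open Drawing D

  Bricks-corner : ∀ {i j} → Bricks D i j → E i j
  Bricks-corner (end _ _ e)        = e
  Bricks-corner (brick _ full _ _) = full ≤-refl (m≤n+m _ _) ≤-refl (m≤n+m _ _)

  size : ∀ {i j} → Bricks D i j → ℕ
  size (end _ _ _)      = 0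
  size (brick _ _ _ bs) = suc (size bs)

  -- The point comes with its edge witness, from which the vertices in `Fin p` and `Fin q` are
  -- recovered later.
  boundaryEdge : ∀ {i j} (bs : Bricks D i j) → Fin (suc (size bs)) → Σ[ e ∈ Point ] Edge e
  boundaryEdge bs               zero    = _ , Bricks-corner bs
  boundaryEdge (brick _ _ _ bs) (suc r) = boundaryEdge bs r

  boundaryPoint : ∀ {i j} (bs : Bricks D i j) → Fin (suc (size bs)) → Point
  boundaryPoint bs r = proj₁ (boundaryEdge bs r)

  infix 4 _⊑_
  _⊑_ : Point → Point → Set
  (i , j) ⊑ (c , d) = i ≤ c × j ≤ d

  ⊑⇒¬Cross : ∀ {e f} → e ⊑ f → ¬ Cross e f
  ⊑⇒¬Cross (_ , b≤d) (inj₁ (_ , d<b)) = <⇒≱ d<b b≤d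
  ⊑⇒¬Cross (a≤c , _) (inj₂ (c<a , _)) = <⇒≱ c<a a≤c

  boundary-beyond : ∀ {i j} (bs : Bricks D i j) r → (i , j) ⊑ boundaryPoint bs r
  boundary-beyond bs               zero    = ≤-refl , ≤-refl
  boundary-beyond (brick {a} {b} _ _ _ bs) (suc r) =
    let p , q = boundary-beyond bs r in m+n≤o⇒n≤o a p , m+n≤o⇒n≤o b q

  boundary-last : ∀ {i j} (bs : Bricks D i j) → boundaryPoint bs (fromℕ (size bs)) ≡ (P , Q)
  boundary-last (end refl refl _) = refl
  boundary-last (brick _ _ _ bs)  = boundary-last bs

  -- By `cover`, an edge not beyond the current brick lies inside it, hence weakly left of all later
  -- boundary edges on both layers.
  boundary-uncrossed : ∀ {i j} (bs : Bricks D i j) r {f} → Edge f → (i , j) ⊑ f →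
                       ¬ Cross (boundaryPoint bs r) f
  boundary-uncrossed bs zero Ef ij⊑f = ⊑⇒¬Cross ij⊑f
  boundary-uncrossed (brick _ _ cover bs) (suc r) Ef (i≤c , j≤d) with cover Ef i≤c j≤d
  ... | inj₁ beyond      = boundary-uncrossed bs r Ef beyond
  ... | inj₂ (c≤ , d≤) = λ cross →
    let p , q = boundary-beyond bs r in
    ⊑⇒¬Cross (≤-trans c≤ p , ≤-trans d≤ q) (Cross-sym _ _ cross)

  Shape-positive : ∀ {a b} → Shape a b → 1 ≤ a × 1 ≤ b
  Shape-positive 2×3 = s≤s z≤n , s≤s z≤n
  Shape-positive 3×2 = s≤s z≤n , s≤s z≤n

  -- Inside a brick, every edge except the two corners crosses `(i , b + j)` or `(a + i , j)`, which
  -- are present because the brick is complete.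
  uncrossed⇒boundary : ∀ {i j} (bs : Bricks D i j) {f} → Edge f → (i , j) ⊑ f →
                       (∀ {g} → Edge g → ¬ Cross f g) → ∃[ r ] f ≡ boundaryPoint bs r
  uncrossed⇒boundary (end refl refl _) Ef (P≤c , Q≤d) _ =
    zero , cong₂ _,_ (≤-antisym (proj₁ (bounded Ef)) P≤c) (≤-antisym (proj₂ (bounded Ef)) Q≤d)
  uncrossed⇒boundary {i} {j} (brick {a} {b} s full cover bs) {c , d} Ef (i≤c , j≤d) ¬cross
    with cover Ef i≤c j≤d
  ... | inj₁ beyond = let r , eq = uncrossed⇒boundary bs Ef beyond ¬cross in suc r , eq
  ... | inj₂ (c≤ , d≤) = corner-of-brick
    where
    1≤a = proj₁ (Shape-positive s)
    1≤b = proj₂ (Shape-positive s)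
    upper-left : E i (b + j)
    upper-left = full ≤-refl (m≤n+m i a) (m≤n+m j b) ≤-refl
    lower-right : E (a + i) j
    lower-right = full (m≤n+m i a) ≤-refl ≤-refl (m≤n+m j b)
    corner-of-brick : ∃[ r ] (c , d) ≡ boundaryPoint (brick {D} s full cover bs) r
    corner-of-brick with m≤n⇒m<n∨m≡n i≤c | m≤n⇒m<n∨m≡n j≤d
    ... | inj₂ refl | inj₂ refl = zero , refl
    ... | inj₂ refl | inj₁ j<d  = contradiction (inj₁ (m<n+m i 1≤a , j<d)) (¬cross lower-right)
    ... | inj₁ i<c  | inj₂ refl = contradiction (inj₂ (i<c , m<n+m j 1≤b)) (¬cross upper-left)
    ... | inj₁ i<c  | inj₁ j<d with m≤n⇒m<n∨m≡n c≤ | m≤n⇒m<n∨m≡n d≤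
    ...   | inj₁ c<   | _         = contradiction (inj₁ (c< , j<d)) (¬cross lower-right)
    ...   | inj₂ _    | inj₁ d<   = contradiction (inj₂ (i<c , d<)) (¬cross upper-left)
    ...   | inj₂ refl | inj₂ refl = suc zero , refl

  Spans : Point → Point → Set
  Spans (i , j) (i′ , j′) =
    ∃[ a ] ∃[ b ] (Shape a b × i′ ≡ a + i × j′ ≡ b + j ×
      (∀ {c d} → i ≤ c → c ≤ i′ → j ≤ d → d ≤ j′ → E c d))

  consecutive : ∀ {i j} (bs : Bricks D i j) r →
                Spans (boundaryPoint bs (inject₁ r)) (boundaryPoint bs (suc r))
  consecutive (brick s full _ bs) zero    = _ , _ , s , refl , refl , full
  consecutive (brick _ _ _ bs)    (suc r) = consecutive bs r

-- From arcs to lattice points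

module _ (ℝ : CompleteOrderedField) (T : TwoLayer.TopologicalGraph ℝ) where
  open Real ℝ using (intermediate; restrict; between-below; between-above; x<x+ε; x-ε<x)
    renaming (<-trans to <ℝ-trans; irrefl to <ℝ-irrefl; ≤-refl to ≤ℝ-refl;
              <-respˡ-≈ to <ℝ-respˡ; <-respʳ-≈ to <ℝ-respʳ)
  open TwoLayer ℝ using (module TopologicalGraph; IsSequenceOfK₂₃; IsBrick; IsK)
  open TopologicalGraph T
  open CompleteOrderedField ℝ using () renaming (_<_ to _<ℝ_; sym to ≈-sym)

  point : Fin p × Fin q → Point
  point (u , v) = toℕ u , toℕ v

  point-injective : ∀ {e f} → point e ≡ point f → e ≡ f
  point-injective eq = cong₂ _,_ (Fin.toℕ-injective (cong proj₁ eq)) (Fin.toℕ-injective (cong proj₂ eq))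

  starts-left : ∀ {e f} → Edge e → Edge f → proj₁ e Fin.< proj₁ f → arc e yᵤ <ℝ arc f yᵤ
  starts-left Ee Ef u<u′ =
    <ℝ-respˡ (≈-sym (arc-start _ Ee)) (<ℝ-respʳ (≈-sym (arc-start _ Ef)) (xᵤ-mono u<u′))

  ends-left : ∀ {e f} → Edge e → Edge f → proj₂ e Fin.< proj₂ f → arc e yᵥ <ℝ arc f yᵥ
  ends-left Ee Ef v<v′ =
    <ℝ-respˡ (≈-sym (arc-end _ Ee)) (<ℝ-respʳ (≈-sym (arc-end _ Ef)) (xᵥ-mono v<v′))

  -- Arcs that start and end in opposite orders meet by the intermediate value argument.
  Cross⇒Crosses : ∀ {e f} → Edge e → Edge f → Cross (point e) (point f) → Crosses e f
  Cross⇒Crosses Ee Ef (inj₁ (u<u′ , v′<v)) =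
    (λ { refl → <-irrefl refl u<u′ }) ,
    intermediate yᵤ<yᵥ (arc-cont _ Ee) (arc-cont _ Ef) (starts-left Ee Ef u<u′) (ends-left Ef Ee v′<v)
  Cross⇒Crosses Ee Ef (inj₂ (u′<u , v<v′)) =
    (λ { refl → <-irrefl refl u′<u }) ,
    let t , p , q , eq = intermediate yᵤ<yᵥ (arc-cont _ Ef) (arc-cont _ Ee)
                           (starts-left Ef Ee u′<u) (ends-left Ee Ef v<v′)
    in t , p , q , ≈-sym eq

  ordered⇒Independent : ∀ {e f} → proj₁ e Fin.< proj₁ f → proj₂ e Fin.< proj₂ f → Independent e f
  ordered⇒Independent u<u′ v<v′ =
    (λ eq → <⇒≢ u<u′ (cong toℕ eq)) , (λ eq → <⇒≢ v<v′ (cong toℕ eq))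

  -- A single proper crossing exchanges the left-to-right order of two arcs, so
  -- arcs whose ends are in the same order on both layers would meet twice.
  ordered⇒¬MeetAt : ∀ {e f} → Edge e → Edge f → proj₁ e Fin.< proj₁ f → proj₂ e Fin.< proj₂ f →
                    ∀ {t} → ¬ MeetAt e f t
  ordered⇒¬MeetAt {e} {f} Ee Ef u<u′ v<v′ {t} meet@(yᵤ<t , t<yᵥ , eq)
    with proper e f t Ee Ef (λ { refl → <-irrefl refl u<u′ }) meet
  -- Just above `t` the arc of `e` is on the right, but it ends on the left, so the arcs meet again
  -- between `s` and `yᵥ`.
  ... | inj₁ (δ , 0<δ , _ , after) with between-below yᵥ _ t<yᵥ (x<x+ε 0<δ)
  ...   | s , t<s , s<yᵥ , s<t+δ
    with intermediate s<yᵥ (restrict (inj₁ yᵤ<s) ≤ℝ-refl (arc-cont _ Ef))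
                           (restrict (inj₁ yᵤ<s) ≤ℝ-refl (arc-cont _ Ee))
                           (after s t<s s<t+δ) (ends-left Ee Ef v<v′)
    where
    yᵤ<s : yᵤ <ℝ s
    yᵤ<s = <ℝ-trans yᵤ<t t<s
  ...     | t′ , s<t′ , t′<yᵥ , eq′ =
    <ℝ-irrefl (independent-cross-≤1 e f t t′ Ee Ef (ordered⇒Independent u<u′ v<v′) meet
                (<ℝ-trans yᵤ<t (<ℝ-trans t<s s<t′) , t′<yᵥ , ≈-sym eq′))
              (<ℝ-trans t<s s<t′)
  ordered⇒¬MeetAt {e} {f} Ee Ef u<u′ v<v′ {t} meet@(yᵤ<t , t<yᵥ , eq)
      -- Just below `t` the arc of `e` is on the right, but it starts on the left, so the arcs
      -- already meet between `yᵤ` and `s`.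
      | inj₂ (δ , 0<δ , before , _) with between-above yᵤ _ yᵤ<t (x-ε<x 0<δ)
  ...   | s , s<t , yᵤ<s , t-δ<s
    with intermediate yᵤ<s (restrict ≤ℝ-refl (inj₁ s<yᵥ) (arc-cont _ Ee))
                           (restrict ≤ℝ-refl (inj₁ s<yᵥ) (arc-cont _ Ef))
                           (starts-left Ee Ef u<u′) (before s t-δ<s s<t)
    where
    s<yᵥ : s <ℝ yᵥ
    s<yᵥ = <ℝ-trans s<t t<yᵥ
  ...     | t′ , yᵤ<t′ , t′<s , eq′ =
    <ℝ-irrefl (independent-cross-≤1 e f t′ t Ee Ef (ordered⇒Independent u<u′ v<v′)
                 (yᵤ<t′ , <ℝ-trans t′<s (<ℝ-trans s<t t<yᵥ) , eq′) meet)
              (<ℝ-trans t′<s s<t)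

  -- Simplicity of the drawing excludes a shared end and equally ordered ends, which leaves only
  -- opposite orders.
  Crosses⇒Cross : ∀ {e f} → Edge e → Edge f → Crosses e f → Cross (point e) (point f)
  Crosses⇒Cross {e} {f} Ee Ef (e≢f , t , meet@(p , q , eq))
    with Fin.<-cmp (proj₁ e) (proj₁ f) | Fin.<-cmp (proj₂ e) (proj₂ f)
  ... | tri< u<u′ _ _ | tri> _ _ v′<v = inj₁ (u<u′ , v′<v)
  ... | tri> _ _ u′<u | tri< v<v′ _ _ = inj₂ (u′<u , v<v′)
  ... | tri≈ _ u≡u′ _ | _ = contradiction meet (adjacent-don't-cross e f t Ee Ef (e≢f , inj₁ u≡u′))
  ... | _ | tri≈ _ v≡v′ _ = contradiction meet (adjacent-don't-cross e f t Ee Ef (e≢f , inj₂ v≡v′))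
  ... | tri< u<u′ _ _ | tri< v<v′ _ _ = contradiction meet (ordered⇒¬MeetAt Ee Ef u<u′ v<v′)
  ... | tri> _ _ u′<u | tri> _ _ v′<v =
    contradiction (p , q , ≈-sym eq) (ordered⇒¬MeetAt Ef Ee u′<u v′<v)

  EdgeAt : ℕ → ℕ → Set
  EdgeAt c d = Σ[ u ∈ Fin p ] Σ[ v ∈ Fin q ] (toℕ u ≡ c × toℕ v ≡ d × Edge (u , v))

  drawing : IsPlanar 2 → Drawing
  drawing planar = record
    { E = EdgeAt
    ; E? = λ c d → Fin.any? λ u → Fin.any? λ v → (toℕ u ≟ c) ×-dec (toℕ v ≟ d) ×-dec Edge? (u , v)
    -- For an empty layer `pred` still names a last vertex 0, which then carries no edge.
    ; P = pred p ; Q = pred q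
    ; bounded = λ { (u , v , refl , refl , _) → Fin.toℕ≤pred[n] u , Fin.toℕ≤pred[n] v }
    ; crossed≤2 = λ { (a , b , refl , refl , Ee) (a₁ , b₁ , refl , refl , Ef)
                      (a₂ , b₂ , refl , refl , Eg) (a₃ , b₃ , refl , refl , Eh) f≢g f≢h g≢h ef eg eh →
        <⇒≱ (n<1+n 2) (planar (a , b) Ee ((a₁ , b₁) ∷ (a₂ , b₂) ∷ (a₃ , b₃) ∷ [])
          (((f≢g ∘ cong point) ∷ (f≢h ∘ cong point) ∷ []) ∷ ((g≢h ∘ cong point) ∷ []) ∷ [] ∷ [])
          (Ef ∷ Eg ∷ Eh ∷ [])
          (Cross⇒Crosses Ee Ef ef ∷ Cross⇒Crosses Ee Eg eg ∷ Cross⇒Crosses Ee Eh eh ∷ [])) }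
    }

  edgeAt : ∀ {e} → Edge e → EdgeAt (toℕ (proj₁ e)) (toℕ (proj₂ e))
  edgeAt Ee = _ , _ , refl , refl , Ee

  edgeOf : ∀ {c d} → EdgeAt c d → Fin p × Fin q
  edgeOf (u , v , _) = u , v

  point-edgeOf : ∀ {c d} (e : EdgeAt c d) → point (edgeOf e) ≡ (c , d)
  point-edgeOf (_ , _ , refl , refl , _) = refl

  Edge-edgeOf : ∀ {c d} (e : EdgeAt c d) → Edge (edgeOf e)
  Edge-edgeOf (_ , _ , _ , _ , Ee) = Ee

  EdgeAt⇒Edge : ∀ {u v} → EdgeAt (toℕ u) (toℕ v) → Edge (u , v)
  EdgeAt⇒Edge (_ , _ , eq , eq′ , Ee) = subst Edge (point-injective (cong₂ _,_ eq eq′)) Ee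

  module _ (planar : IsPlanar 2) (bs : Bricks (drawing planar) 0 0) where

    boundary : Fin (suc (size bs)) → Fin p × Fin q
    boundary r = edgeOf (proj₂ (boundaryEdge bs r))

    point-boundary : ∀ r → point (boundary r) ≡ boundaryPoint bs r
    point-boundary r = point-edgeOf (proj₂ (boundaryEdge bs r))

    boundary-planar : ∀ r → Planar (boundary r)
    boundary-planar r = Er , λ f Ef crosses →
      boundary-uncrossed bs r (edgeAt Ef) (z≤n , z≤n)
        (subst (λ e → Cross e (point f)) (point-boundary r) (Crosses⇒Cross Er Ef crosses))
      where
      Er : Edge (boundary r)
      Er = Edge-edgeOf (proj₂ (boundaryEdge bs r))

    planar⇒boundary : ∀ {e} → Planar e → ∃[ r ] e ≡ boundary r
    planar⇒boundary (Ee , uncrossed) =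
      let r , eq = uncrossed⇒boundary bs (edgeAt Ee) (z≤n , z≤n)
                     λ { (u , v , refl , refl , Ef) cross → uncrossed _ Ef (Cross⇒Crosses Ee Ef cross) }
      in r , point-injective (trans eq (sym (point-boundary r)))

    spans : ∀ r → Spans {drawing planar} (point (boundary (inject₁ r))) (point (boundary (suc r)))
    spans r = subst₂ (Spans {drawing planar}) (sym (point-boundary (inject₁ r)))
                     (sym (point-boundary (suc r))) (consecutive bs r)

    isBrick : ∀ {l r} → Planar l → Planar r → Spans {drawing planar} (point l) (point r) → IsBrick T l r
    isBrick {l} {r} l-planar r-planar (a , b , s , eqᵤ , eqᵥ , _) = record
      { planarˡ = l-planar ; planarʳ = r-planar
      ; distinct = λ { refl → <⇒≢ (m<n+m _ (proj₁ (Shape-positive {drawing planar} s))) eqᵤ }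
      ; i≤j = subst (toℕ (proj₁ l) ≤_) (sym eqᵤ) (m≤n+m _ a)
      ; x≤y = subst (toℕ (proj₂ l) ≤_) (sym eqᵥ) (m≤n+m _ b)
      }

    isK : ∀ {l r a b} → toℕ (proj₁ r) ≡ a + toℕ (proj₁ l) → toℕ (proj₂ r) ≡ b + toℕ (proj₂ l) →
          (∀ {c d} → toℕ (proj₁ l) ≤ c → c ≤ toℕ (proj₁ r) → toℕ (proj₂ l) ≤ d → d ≤ toℕ (proj₂ r) →
            EdgeAt c d) → IsK T (suc a) (suc b) l r
    isK eqᵤ eqᵥ full = record
      { sizeᵤ = cong suc eqᵤ ; sizeᵥ = cong suc eqᵥ
      ; complete = λ u v p q r s → EdgeAt⇒Edge (full p q r s) }

    isSequenceOfK₂₃ : IsSequenceOfK₂₃ T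
    isSequenceOfK₂₃ = record
      { β = size bs ; boundary = boundary
      ; planarEdges = λ e → mk⇔ planar⇒boundary (λ { (r , refl) → boundary-planar r })
      ; leftEnd = λ u v → subst (λ (c , d) → c ≤ toℕ u × d ≤ toℕ v) (sym (point-boundary zero)) (z≤n , z≤n)
      ; rightEnd = λ u v → subst (λ (c , d) → toℕ u ≤ c × toℕ v ≤ d)
          (sym (trans (point-boundary (fromℕ (size bs))) (boundary-last bs)))
          (Fin.toℕ≤pred[n] u , Fin.toℕ≤pred[n] v)
      ; brick = λ r → isBrick (boundary-planar (inject₁ r)) (boundary-planar (suc r)) (spans r)
      ; K₂₃ = λ r → K₂₃ (spans r)
      }
      where
      K₂₃ : ∀ {l r} → Spans {drawing planar} (point l) (point r) → IsK T 2 3 l r ⊎ IsK T 3 2 l r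
      K₂₃ (_ , _ , 2×3 , eqᵤ , eqᵥ , full) = inj₁ (isK eqᵤ eqᵥ full)
      K₂₃ (_ , _ , 3×2 , eqᵤ , eqᵥ , full) = inj₂ (isK eqᵤ eqᵥ full)

  -- Counting the drawn edges

  drawnEdges : List (Fin p × Fin q)
  drawnEdges = filter Edge? (cartesianProduct (allFin p) (allFin q))

  drawnEdges-unique : Unique drawnEdges
  drawnEdges-unique = Unique.filter⁺ Edge? (Unique.cartesianProduct⁺ (Unique.allFin⁺ p) (Unique.allFin⁺ q))

  ∈drawnEdges : ∀ {e} → Edge e → e ∈ drawnEdges
  ∈drawnEdges Ee = ∈-filter⁺ Edge? (∈-cartesianProduct⁺ (∈-allFin _) (∈-allFin _)) Ee

  drawnEdges-bound : (planar : IsPlanar 2) →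
                     3 * length drawnEdges ≤ 5 * (pred p + pred q) + 3 ×
                     (3 * length drawnEdges ≡ 5 * (pred p + pred q) + 3 → Bricks (drawing planar) 0 0)
  drawnEdges-bound planar =
    subst (λ k → k ≤ r × (k ≡ r → Bricks (drawing planar) 0 0)) k≡
      (bound (drawing planar) (pred p + pred q) z≤n z≤n (m≤m+n _ 0)
        (Unique.map⁺ point-injective drawnEdges-unique)
        (All.tabulate within))
    where
    r : ℕ
    r = 5 * (pred p + pred q) + 3
    k≡ : 3 * length (map point drawnEdges) + 0 ≡ 3 * length drawnEdges
    k≡ = trans (+-identityʳ _) (cong (3 *_) (length-map point drawnEdges))
    within : ∀ {e} → e ∈ map point drawnEdges → Within (drawing planar) 0 0 e
    within e∈ with ∈-map⁻ point e∈
    ... | f , f∈ , refl =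
      edgeAt (proj₂ (∈-filter⁻ Edge? {xs = cartesianProduct (allFin p) (allFin q)} f∈)) ,
      z≤n , z≤n

-- Transfer to abstract graphs

module _ (ℝ : CompleteOrderedField) where
  open TwoLayer ℝ

  order : ∀ {n} (G : Graph (Fin n)) (T : TopologicalGraph) → G ≅ underlying T →
          let open TopologicalGraph T in n ≡ p + q
  order G T G≅T = ↔⇒≡ (↔-sym Fin.+↔⊎ ↔-∘ _≅_.bijection G≅T)

  -- The isomorphism sends each edge of `G` to a drawn edge, so the edges of `G` lie in the image of
  -- the drawn ones under `ends`.
  ∣E∣≤drawnEdges : ∀ {n} (G : Graph (Fin n)) (T : TopologicalGraph) → G ≅ underlying T →
                   ∣E∣ G ≤ length (drawnEdges ℝ T)
  ∣E∣≤drawnEdges {n} G T G≅T =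
    subst (∣E∣ G ≤_) (length-map ends (drawnEdges ℝ T)) (length-⊆ edges-unique sub)
    where
    open Graph G
    open TopologicalGraph T
    open _≅_ G≅T
    open Inverse bijection
    edge? : Decidable (λ ((i , j) : Fin n × Fin n) → (i Fin.< j) × (i ~ j))
    edge? (i , j) = (i Fin.<? j) ×-dec (i ~? j)
    edges-unique : Unique (edges G)
    edges-unique = Unique.filter⁺ edge? (Unique.cartesianProduct⁺ (Unique.allFin⁺ n) (Unique.allFin⁺ n))
    -- `edges` lists each edge as an increasing pair, whereas either end may lie on either layer.
    sort : Fin n × Fin n → Fin n × Fin n
    sort (i , j) with i Fin.<? j
    ... | yes _ = i , j
    ... | no _  = j , i
    sort-< : ∀ {i j} → i Fin.< j → sort (i , j) ≡ (i , j)
    sort-< {i} {j} i<j with i Fin.<? j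
    ... | yes _  = refl
    ... | no i≮j = contradiction i<j i≮j
    sort-> : ∀ {i j} → i Fin.< j → sort (j , i) ≡ (i , j)
    sort-> {i} {j} i<j with j Fin.<? i
    ... | yes j<i = contradiction j<i (<⇒≯ i<j)
    ... | no _    = refl
    ends : Fin p × Fin q → Fin n × Fin n
    ends (u , v) = sort (from (inj₁ u) , from (inj₂ v))
    sub : ∀ {e} → e ∈ edges G → e ∈ map ends (drawnEdges ℝ T)
    sub {i , j} e∈ with ∈-filter⁻ edge? {xs = cartesianProduct (allFin n) (allFin n)} e∈
    ... | _ , i<j , i~j with to i in eqᵢ | to j in eqⱼ | Equivalence.to (adjacency i j) i~j
    ...   | inj₁ u | inj₂ v | Euv =
      subst (_∈ map ends (drawnEdges ℝ T))
        (trans (cong₂ (λ x y → sort (x , y)) (inverseʳ (sym eqᵢ)) (inverseʳ (sym eqⱼ))) (sort-< i<j))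
        (∈-map⁺ ends (∈drawnEdges ℝ T Euv))
    ...   | inj₂ v | inj₁ u | Euv =
      subst (_∈ map ends (drawnEdges ℝ T))
        (trans (cong₂ (λ x y → sort (x , y)) (inverseʳ (sym eqⱼ)) (inverseʳ (sym eqᵢ))) (sort-> i<j))
        (∈-map⁺ ends (∈drawnEdges ℝ T Euv))

  zero-or-suc : ∀ m → m ≡ 0 ⊎ m ≡ suc (pred m)
  zero-or-suc zero    = inj₁ refl
  zero-or-suc (suc _) = inj₂ refl

  ¬drawnEdges : ∀ {n} (G : Graph (Fin n)) (T : TopologicalGraph) → G ≅ underlying T →
    let open TopologicalGraph T in ¬ (Fin p × Fin q) → ∣E∣ G ≡ 0
  ¬drawnEdges G T G≅T ¬e with drawnEdges ℝ T | ∣E∣≤drawnEdges G T G≅T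
  ... | []    | ∣E∣≤0 = n≤0⇒n≡0 ∣E∣≤0
  ... | e ∷ _ | _     = contradiction e ¬e

  -- Here `2 ≤ n` enters: an edgeless graph satisfies the bound since `7 < 10 ≤ 5 * n`.
  few-edges : ∀ n e → 2 ≤ n → e ≡ 0 → 3 * e + 7 < 5 * n
  few-edges n _ 2≤n refl = ≤-trans (<ᵇ⇒< 7 10 _) (*-monoʳ-≤ 5 2≤n)

  -- An empty layer leaves no edges. Otherwise `n = pred p + pred q + 2` turns the bound on drawn
  -- edges into the claim, and equality for `G` forces equality for the given drawing, which is
  -- itself the sequence.
  density : ∀ {n} (G : Graph (Fin n)) → 2 ≤ n → ((T , _ , _) : Is2Layer[ 2 ]Planar G) →
            3 * ∣E∣ G + 7 ≤ 5 * n × (3 * ∣E∣ G + 7 ≡ 5 * n → IsSequenceOfK₂₃ T)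
  density {n} G 2≤n (T , G≅T , planar) = result (zero-or-suc p) (zero-or-suc q)
    where
    open TopologicalGraph T
    open ≤-Reasoning

    L : ℕ
    L = length (drawnEdges ℝ T)

    no-edges : ¬ (Fin p × Fin q) →
               3 * ∣E∣ G + 7 ≤ 5 * n × (3 * ∣E∣ G + 7 ≡ 5 * n → IsSequenceOfK₂₃ T)
    no-edges ¬e = <⇒≤ few , λ eq → contradiction eq (<⇒≢ few)
      where
      few : 3 * ∣E∣ G + 7 < 5 * n
      few = few-edges n (∣E∣ G) 2≤n (¬drawnEdges G T G≅T ¬e)

    result : p ≡ 0 ⊎ p ≡ suc (pred p) → q ≡ 0 ⊎ q ≡ suc (pred q) →
             3 * ∣E∣ G + 7 ≤ 5 * n × (3 * ∣E∣ G + 7 ≡ 5 * n → IsSequenceOfK₂₃ T)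
    result (inj₁ p≡0) _          = no-edges λ (u , _) → Fin.¬Fin0 (subst Fin p≡0 u)
    result _          (inj₁ q≡0) = no-edges λ (_ , v) → Fin.¬Fin0 (subst Fin q≡0 v)
    result (inj₂ p≡)  (inj₂ q≡)  =
      (begin
        3 * ∣E∣ G + 7                     ≤⟨ fewer ⟩
        3 * L + 7                         ≤⟨ +-monoˡ-≤ 7 L-bound ⟩
        5 * (pred p + pred q) + 3 + 7     ≡⟨ 5n≡ ⟨
        5 * n                             ∎) ,
      λ eq → isSequenceOfK₂₃ ℝ T planar (L-optimal (≤-antisym L-bound (+-cancelʳ-≤ 7 _ _ (begin
        5 * (pred p + pred q) + 3 + 7     ≡⟨ 5n≡ ⟨
        5 * n                             ≡⟨ eq ⟨
        3 * ∣E∣ G + 7                     ≤⟨ fewer ⟩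
        3 * L + 7                         ∎))))
      where
      L-bound : 3 * L ≤ 5 * (pred p + pred q) + 3
      L-bound = proj₁ (drawnEdges-bound ℝ T planar)
      L-optimal : 3 * L ≡ 5 * (pred p + pred q) + 3 → Bricks (drawing ℝ T planar) 0 0
      L-optimal = proj₂ (drawnEdges-bound ℝ T planar)
      fewer : 3 * ∣E∣ G + 7 ≤ 3 * L + 7
      fewer = +-monoˡ-≤ 7 (*-monoʳ-≤ 3 (∣E∣≤drawnEdges G T G≅T))
      lemma : ∀ P Q → 5 * (suc P + suc Q) ≡ 5 * (P + Q) + 3 + 7
      lemma = solve-∀
      5n≡ : 5 * n ≡ 5 * (pred p + pred q) + 3 + 7
      5n≡ = trans (cong (5 *_) (trans (order G T G≅T) (cong₂ _+_ p≡ q≡))) (lemma (pred p) (pred q))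

theorem2 : (ℝ : CompleteOrderedField) → let open TwoLayer ℝ in
    (n : ℕ) → 2 ≤ n → (G : Graph (Fin n)) → Is2Layer[ 2 ]Planar G →
    (3 * ∣E∣ G + 7 ≤ 5 * n) ×
    (3 * ∣E∣ G + 7 ≡ 5 * n → SequenceOfK₂₃ G)
theorem2 ℝ n 2≤n G drawn@(T , G≅T , planar) =
  let bound , optimal = density ℝ G 2≤n drawn in bound , λ eq → T , G≅T , optimal eq
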